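{- Let $\mathcal P_1,\ldots,\mathcal P_n$ be ranked posets. Whenever the respective constructions are defined, the following are equivalent: (1) $\bigsqcup_{i=1}^n\underline{\mathcal P_i}$ is Macaulay; (2) $\bigvee_{i=1}^n\mathcal P_i$ is Macaulay; (3) $\Diamond_{i=1}^n\widehat{\mathcal P_i}$ is Macaulay. That is: if every $\mathcal P_i$ has a unique least element, then (1) and (2) are equivalent; if moreover all maximal elements of all the $\mathcal P_i$ have one common rank, then (1), (2) and (3) are equivalent. Moreover, whenever the respective constructions are defined, (1')$\Rightarrow$(2')$\Rightarrow$(3'), where (1') $\bigsqcup_{i=1}^n\mathcal P_i$ is Macaulay; (2') $\bigvee_{i=1}^n\mathcal P_i$ is Macaulay; (3') $\Diamond_{i=1}^n\mathcal P_i$ is Macaulay. That is: (1')$\Rightarrow$(2') if every $\mathcal P_i$ has a unique least element; (2')$\Rightarrow$(3') if every $\mathcal P_i$ has a unique least and a unique largest element and all $\mathcal P_i$ have the same rank.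
   Context: A poset $\mathcal P$ is ranked if there is a function $r:\mathcal P\to\mathbb N=\{0,1,\dots\}$ such that some minimal element has rank $0$ and $r(b)=r(a)+1$ whenever $b$ covers $a$. The rank of $\mathcal P$ is the largest rank of an element; $\mathcal P_{[d]}$ is the set of elements of rank $d$. Levels are assumed finite. For $A\subseteq\mathcal P$ the upper shadow is $\nabla_{\mathcal P}A=\{b\in\mathcal P: b\text{ covers some }a\in A\}$. Given an additional total order on $\mathcal P$ (not required to be related to the partial order), $\mathrm{Seg}_d\,q$ is the set of the $q$ largest elements of $\mathcal P_{[d]}$ in the total order. $\mathcal P$ is Macaulay if there is a total order such that for every $d$ and every $A\subseteq\mathcal P_{[d]}$: (i) $|\nabla\mathrm{Seg}_d|A||\le|\nabla A|$, and (ii) $\nabla\mathrm{Seg}_d|A|=\mathrm{Seg}_{d+1}|\nabla\mathrm{Seg}_d|A||$. (The empty poset is vacuously Macaulay.) $\underline{\mathcal P}$ is $\mathcal P$ with its unique smallest element removed (ranks shifted down by one). $\widehat{\mathcal P}$ is $\mathcal P$ with a new element added that is larger than all elements of $\mathcal P$. The disjoint union $\bigsqcup\mathcal P_i$ has $a\le b$ iff $a,b$ lie in the same $\mathcal P_i$ and $a\le b$ there. The wedge product $\bigvee\mathcal P_i$ (for posets with unique least elements) is the disjoint union with all least elements identified to one element. The diamond product $\Diamond\mathcal P_i$ (for ranked posets of the same rank with unique least and unique largest elements) is the disjoint union with all least elements identified to one element and all largest elements identified to another. In the last two, $a\le b$ iff $a\le b$ in some $\mathcal P_i$. Ranks in all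 these posets are inherited from the $\mathcal P_i$.
   Formalization: The rank function is also required to be strictly increasing (a<b implies r(a)<r(b)), automatic for finite posets but needed for infinite ones, where the claim can otherwise fail; equality and order of the posets are assumed decidable, which excluded middle supplies. -}

module Defs where

open import Data.Fin.Base using (Fin)
import Data.Fin.Properties as Fin
open import Data.List.Base using (List; []; _∷_; length; map; concatMap; allFin)
import Data.List.Membership.Setoid as Membership
open import Data.List.Membership.Propositional.Properties using (∈-allFin)
open import Data.List.Relation.Unary.All using (All)
open import Data.List.Relation.Unary.Any as Any using (Any; here; there)
import Data.List.Relation.Unary.Any.Properties as Any
import Data.List.Relation.Unary.Unique.Setoid as UniqueSetoid
open import Data.Nat.Base as ℕ using (ℕ; suc)
import Data.Nat.Properties as ℕ
open import Data.Nat.Induction using (<-wellFounded)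
open import Data.Product.Base using (Σ; ∃; ∃₂; _×_; _,_; proj₁; proj₂)
open import Function.Base using (_∘_; _on_)
open import Induction.WellFounded using (Acc; acc)
open import Level using (Level; _⊔_; 0ℓ) renaming (suc to lsuc)
open import Relation.Binary.Bundles using (DecPoset)
open import Relation.Binary.Core using (Rel; _Preserves_⟶_)
open import Relation.Binary.Definitions using (Decidable; Maximum; Minimum)
open import Relation.Binary.PropositionalEquality using (_≡_; refl; sym; trans; cong; subst; subst₂)
open import Relation.Binary.Structures using (IsDecEquivalence; IsDecPartialOrder; IsDecTotalOrder)
import Relation.Binary.Construct.Add.Supremum.Equality as AddEquality
import Relation.Binary.Construct.Add.Supremum.NonStrict as AddSupremum
import Relation.Binary.Construct.NonStrictToStrict as ToStrict
import Relation.Binary.Construct.On as On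
open import Relation.Nullary using (¬_; Dec; yes; no; contradiction)
open import Relation.Nullary.Construct.Add.Supremum using (_⁺; [_]; ⊤⁺)
open import Relation.Nullary.Decidable using (map′; _×-dec_; ¬?)
open import Relation.Unary using (Pred; _≐_)

private
  variable
    c ℓ₁ ℓ₂ ℓ : Level
    n : ℕ

-- Equality and order are decidable, which classically is no restriction.
--
-- `rank-<` follows from `rank-⋖` when every interval contains a finite
-- maximal chain, in particular in finite posets.  In an infinite poset
-- `rank-⋖` alone does not control `rank`: an element above 0 < 1 < 2 < …
-- covers nothing, so it could be given any rank whatsoever.
--
-- `rank-zero` is conditional on an element so that the empty poset is
-- ranked.

record RankedPoset c ℓ₁ ℓ₂ : Set (lsuc (c ⊔ ℓ₁ ⊔ ℓ₂)) where
  field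
    decPoset : DecPoset c ℓ₁ ℓ₂

  open DecPoset decPoset public
    using (Carrier; _≈_; _≤_; _≟_; _≤?_; isDecPartialOrder; module Eq)
    renaming (refl to ≤-refl; trans to ≤-trans; antisym to ≤-antisym;
              reflexive to ≤-reflexive; ≤-respˡ-≈ to ≤-respˡ; ≤-respʳ-≈ to ≤-respʳ)

  open ToStrict _≈_ _≤_ public using (_<_)
  open Membership Eq.setoid public using (_∈_)
  open UniqueSetoid Eq.setoid public using (Unique)

  infix 4 _⋖_

  -- a ⋖ b : b covers a
  _⋖_ : Rel Carrier (c ⊔ ℓ₁ ⊔ ℓ₂)
  a ⋖ b = a < b × (∀ z → ¬ (a < z × z < b))

  Minimal : Pred Carrier (c ⊔ ℓ₁ ⊔ ℓ₂)
  Minimal x = ∀ y → ¬ (y < x)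

  Maximal : Pred Carrier (c ⊔ ℓ₁ ⊔ ℓ₂)
  Maximal x = ∀ y → ¬ (x < y)

  field
    rank         : Carrier → ℕ
    rank-cong    : rank Preserves _≈_ ⟶ _≡_
    rank-zero    : Carrier → ∃ λ x → Minimal x × rank x ≡ 0
    rank-⋖       : ∀ {a b} → a ⋖ b → rank b ≡ suc (rank a)
    rank-<       : ∀ {a b} → a < b → rank a ℕ.< rank b
    level-finite : ∀ d → ∃ λ xs → ∀ x → rank x ≡ d → x ∈ xs

Least : RankedPoset c ℓ₁ ℓ₂ → Set _
Least P = ∃ λ ⊥ → Minimum _≤_ ⊥
  where open RankedPoset P

Greatest : RankedPoset c ℓ₁ ℓ₂ → Set _
Greatest P = ∃ λ ⊤ → Maximum _≤_ ⊤
  where open RankedPoset P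

HasRank : RankedPoset c ℓ₁ ℓ₂ → ℕ → Set _
HasRank P m = (∀ x → rank x ℕ.≤ m) × ∃ λ x → rank x ≡ m
  where open RankedPoset P

MaximalsHaveRank : RankedPoset c ℓ₁ ℓ₂ → ℕ → Set _
MaximalsHaveRank P m = ∀ x → Maximal x → rank x ≡ m
  where open RankedPoset P

module _ (P : RankedPoset c ℓ₁ ℓ₂) where
  open RankedPoset P

  infix 4 _HasSize_

  _HasSize_ : Pred Carrier ℓ → ℕ → Set _
  S HasSize q = ∃ λ xs → Unique xs × length xs ≡ q × S ≐ (_∈ xs)

  ∇ : Pred Carrier ℓ → Pred Carrier _
  ∇ S b = ∃ λ a → S a × a ⋖ b

  -- The q largest elements of level d are those elements of level d with
  -- fewer than q elements of level d above them.
  Seg : Rel Carrier ℓ → ℕ → ℕ → Pred Carrier _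
  Seg _⊑_ d q x = rank x ≡ d × ∃ λ k → k ℕ.< q × (λ y → rank y ≡ d × x ⊏ y) HasSize k
    where open ToStrict _≈_ _⊑_ renaming (_<_ to _⊏_)

  -- A subset of the (finite) level d is given by a repetition-free list A
  -- of elements of rank d, so its cardinality is `length A`.
  -- Shadows always have a unique size, so nothing is lost or gained by
  -- asserting the existence of the sizes s and t.
  IsMacaulayOrder : Rel Carrier ℓ → Set _
  IsMacaulayOrder _⊑_ =
    ∀ d (A : List Carrier) → Unique A → All (λ a → rank a ≡ d) A →
    let ∇Seg = ∇ (Seg _⊑_ d (length A)) in
    ∃₂ λ s t → ∇Seg HasSize s
             × ∇ (_∈ A) HasSize t
             × s ℕ.≤ t
             × ∇Seg ≐ Seg _⊑_ (suc d) s

  -- A decidable relation is equivalent to one in the lowest universe, so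
  -- fixing the universe of the total order is no restriction.
  Macaulay : Set _
  Macaulay = ∃ λ (_⊑_ : Rel Carrier 0ℓ) → IsDecTotalOrder _≈_ _⊑_ × IsMacaulayOrder _⊑_

module Facts (P : RankedPoset c ℓ₁ ℓ₂) where
  open RankedPoset P

  infix 4 _<?_
  _<?_ : Decidable _<_
  _<?_ = ToStrict.<-decidable _≈_ _≤_ _≟_ _≤?_

  rank-≤ : ∀ {x y} → x ≤ y → rank x ℕ.≤ rank y
  rank-≤ {x} {y} x≤y with x ≟ y
  ... | yes x≈y = ℕ.≤-reflexive (rank-cong x≈y)
  ... | no  x≉y = ℕ.<⇒≤ (rank-< (x≤y , x≉y))

  rank-≈ : ∀ {x y} → x ≤ y → rank y ℕ.≤ rank x → x ≈ y
  rank-≈ {x} {y} x≤y r with x ≟ y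
  ... | yes x≈y = x≈y
  ... | no  x≉y = contradiction (rank-< (x≤y , x≉y)) (ℕ.≤⇒≯ r)

  rank-least : ((⊥ , _) : Least P) → rank ⊥ ≡ 0
  rank-least (⊥ , ⊥≤) with rank-zero ⊥
  ... | x , _ , rx≡0 = ℕ.n≤0⇒n≡0 (ℕ.≤-trans (rank-≤ (⊥≤ x)) (ℕ.≤-reflexive rx≡0))

  rank-greatest : ∀ {m} → ((⊤ , _) : Greatest P) → HasRank P m → rank ⊤ ≡ m
  rank-greatest (⊤ , ≤⊤) (bound , x , rx≡m) =
    ℕ.≤-antisym (bound ⊤) (ℕ.≤-trans (ℕ.≤-reflexive (sym rx≡m)) (rank-≤ (≤⊤ x)))

module _ (P : RankedPoset c ℓ₁ ℓ₂) (least : Least P) where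
  private
    open RankedPoset P
    open Facts P

    ⊥ = proj₁ least
    ⊥≤ = proj₂ least

    Carrier₋ : Set _
    Carrier₋ = ∃ λ x → ¬ (x ≈ ⊥)

    _<₋_ : Rel Carrier₋ _
    _<₋_ = _<_ on proj₁

    _⋖₋_ : Rel Carrier₋ _
    a ⋖₋ b = a <₋ b × (∀ z → ¬ (a <₋ z × z <₋ b))

    Minimal₋ : Pred Carrier₋ _
    Minimal₋ x = ∀ y → ¬ (y <₋ x)

    rank₋ : Carrier₋ → ℕ
    rank₋ (x , _) = ℕ.pred (rank x)

    rank-positive : ((x , _) : Carrier₋) → 0 ℕ.< rank x
    rank-positive (x , x≉⊥) =
      ℕ.≤-<-trans ℕ.z≤n (rank-< (⊥≤ x , x≉⊥ ∘ Eq.sym))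

    suc-rank₋ : ∀ a → suc (rank₋ a) ≡ rank (proj₁ a)
    suc-rank₋ a with rank (proj₁ a) | rank-positive a
    ... | suc _ | _ = refl

    above : ∀ {x z} → ¬ (x ≈ ⊥) → x ≤ z → ¬ (z ≈ ⊥)
    above x≉⊥ x≤z z≈⊥ = x≉⊥ (≤-antisym (≤-respʳ z≈⊥ x≤z) (⊥≤ _))

    rank₋-⋖ : ∀ {a b} → a ⋖₋ b → rank₋ b ≡ suc (rank₋ a)
    rank₋-⋖ {a} {b} (a<b , none) = trans
      (cong ℕ.pred (rank-⋖ (a<b , λ { z (a<z , z<b) →
        none (z , above (proj₂ a) (proj₁ a<z)) (a<z , z<b) })))
      (sym (suc-rank₋ a))

    rank₋-< : ∀ {a b} → a <₋ b → rank₋ a ℕ.< rank₋ b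
    rank₋-< {a} {b} a<b = ℕ.≤-pred
      (subst₂ ℕ._<_ (sym (suc-rank₋ a)) (sym (suc-rank₋ b)) (rank-< a<b))

    below? : ∀ a → Dec (∃ λ b → b <₋ a)
    below? a@(x , _) = map′ to from (ℕ.anyUpTo? (λ d → Any.any? ok? (xs d)) (rank x))
      where
      xs : ℕ → List Carrier
      xs d = proj₁ (level-finite d)

      Ok : Pred Carrier _
      Ok y = ¬ (y ≈ ⊥) × y < x

      ok? : ∀ y → Dec (Ok y)
      ok? y = ¬? (y ≟ ⊥) ×-dec (y <? x)

      to : (∃ λ d → d ℕ.< rank x × Any Ok (xs d)) → ∃ λ b → b <₋ a
      to (_ , _ , any) with Any.satisfied any
      ... | y , y≉⊥ , y<x = (y , y≉⊥) , y<x

      resp : ∀ {y z} → Ok y → y ≈ z → Ok z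
      resp (y≉⊥ , y≤x , y≉x) y≈z =
        (λ z≈⊥ → y≉⊥ (Eq.trans y≈z z≈⊥)) , ≤-respˡ y≈z y≤x , (λ z≈x → y≉x (Eq.trans y≈z z≈x))

      from : (∃ λ b → b <₋ a) → ∃ λ d → d ℕ.< rank x × Any Ok (xs d)
      from ((y , y≉⊥) , y<x) =
        rank y , rank-< y<x ,
        Any.map (resp (y≉⊥ , y<x)) (proj₂ (level-finite (rank y)) y refl)

    rank₋-minimal : ∀ a → Minimal₋ a → rank₋ a ≡ 0
    rank₋-minimal (x , x≉⊥) min = cong ℕ.pred (trans
      (rank-⋖ ((⊥≤ x , x≉⊥ ∘ Eq.sym) , λ { z (⊥<z , z<x) →
        min (z , proj₂ ⊥<z ∘ Eq.sym) z<x }))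
      (cong suc (rank-least least)))

    rank₋-zero : ∀ a → Acc ℕ._<_ (rank₋ a) → ∃ λ b → Minimal₋ b × rank₋ b ≡ 0
    rank₋-zero a (acc rec) with below? a
    ... | yes (b , b<a) = rank₋-zero b (rec (rank₋-< {b} {a} b<a))
    ... | no  none      = a , min , rank₋-minimal a min
      where
      min : Minimal₋ a
      min b b<a = none (b , b<a)

    restrict : List Carrier → List Carrier₋
    restrict [] = []
    restrict (x ∷ xs) with x ≟ ⊥
    ... | yes _   = restrict xs
    ... | no  x≉⊥ = (x , x≉⊥) ∷ restrict xs

    restrict⁺ : ∀ ((x , x≉⊥) : Carrier₋) {xs} → x ∈ xs → Any (λ b → x ≈ proj₁ b) (restrict xs)
    restrict⁺ a@(x , x≉⊥) {y ∷ _} x∈ with y ≟ ⊥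
    restrict⁺ a@(x , x≉⊥) (here x≈y)  | yes y≈⊥ = contradiction (Eq.trans x≈y y≈⊥) x≉⊥
    restrict⁺ a           (there x∈)  | yes _   = restrict⁺ a x∈
    restrict⁺ a           (here x≈y)  | no  _   = here x≈y
    restrict⁺ a           (there x∈)  | no  _   = there (restrict⁺ a x∈)

  RemoveLeast : RankedPoset (c ⊔ ℓ₁) ℓ₁ ℓ₂
  RemoveLeast = record
    { decPoset     = On.decPoset {B = Carrier₋} decPoset proj₁
    ; rank         = rank₋
    ; rank-cong    = λ x≈y → cong ℕ.pred (rank-cong x≈y)
    ; rank-zero    = λ a → rank₋-zero a (<-wellFounded _)
    ; rank-⋖       = λ {a} {b} → rank₋-⋖ {a} {b}
    ; rank-<       = λ {a} {b} → rank₋-< {a} {b}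
    ; level-finite = λ d → restrict (proj₁ (level-finite (suc d))) , λ a r →
        restrict⁺ a (proj₂ (level-finite (suc d)) (proj₁ a) (trans (sym (suc-rank₋ a)) (cong suc r)))
    }

-- The hypotheses are what is needed for the result to be ranked: the new
-- element covers exactly the maximal elements of P.

module _ (P : RankedPoset c ℓ₁ ℓ₂) {m : ℕ} (hasRank : HasRank P m)
         (maximals : MaximalsHaveRank P m) where
  private
    open RankedPoset P
    open Facts P
    open AddEquality _≈_ using (_≈⁺_; ⊤⁺≈⊤⁺) renaming ([_] to ≈[_])
    open AddSupremum _≤_ using (_≤⁺_; _≤⊤⁺; ≤⁺-isDecPartialOrder) renaming ([_] to ≤[_])
    open ToStrict _≈⁺_ _≤⁺_ using () renaming (_<_ to _<⁺_)

    rank⁺ : Carrier ⁺ → ℕ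
    rank⁺ [ x ] = rank x
    rank⁺ ⊤⁺    = suc m

    <[_] : ∀ {x y} → x < y → [ x ] <⁺ [ y ]
    <[ x≤y , x≉y ] = ≤[ x≤y ] , λ { ≈[ x≈y ] → x≉y x≈y }

    <⊤ : ∀ {x} → [ x ] <⁺ ⊤⁺
    <⊤ = (_ ≤⊤⁺) , λ ()

    drop : ∀ {x y} → [ x ] <⁺ [ y ] → x < y
    drop (≤[ x≤y ] , x≉y) = x≤y , λ x≈y → x≉y ≈[ x≈y ]

    rank⁺-cong : ∀ {a b} → a ≈⁺ b → rank⁺ a ≡ rank⁺ b
    rank⁺-cong ≈[ x≈y ] = rank-cong x≈y
    rank⁺-cong ⊤⁺≈⊤⁺    = refl

    rank⁺-⋖ : ∀ {a b} → a <⁺ b × (∀ z → ¬ (a <⁺ z × z <⁺ b)) → rank⁺ b ≡ suc (rank⁺ a)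
    rank⁺-⋖ {[ x ]} {[ y ]} (x<y , none) =
      rank-⋖ (drop x<y , λ { z (x<z , z<y) → none [ z ] (<[ x<z ] , <[ z<y ]) })
    rank⁺-⋖ {[ x ]} {⊤⁺} (_ , none) =
      cong suc (sym (maximals x λ y x<y → none [ y ] (<[ x<y ] , <⊤)))
    rank⁺-⋖ {⊤⁺} {⊤⁺} ((_ , ⊤≉⊤) , _) = contradiction ⊤⁺≈⊤⁺ ⊤≉⊤
    rank⁺-⋖ {⊤⁺} {[ _ ]} ((() , _) , _)

    rank⁺-< : ∀ {a b} → a <⁺ b → rank⁺ a ℕ.< rank⁺ b
    rank⁺-< {[ _ ]} {[ _ ]} x<y       = rank-< (drop x<y)
    rank⁺-< {[ x ]} {⊤⁺}    _         = ℕ.s≤s (proj₁ hasRank x)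
    rank⁺-< {⊤⁺}    {⊤⁺}    (_ , ⊤≉⊤) = contradiction ⊤⁺≈⊤⁺ ⊤≉⊤
    rank⁺-< {⊤⁺}    {[ _ ]} (() , _)

    rank⁺-zero : ∃ λ a → (∀ b → ¬ (b <⁺ a)) × rank⁺ a ≡ 0
    rank⁺-zero with rank-zero (proj₁ (proj₂ hasRank))
    ... | x , min , rx≡0 = [ x ] , (λ { [ y ] y<x → min y (drop y<x) ; ⊤⁺ (() , _) }) , rx≡0

    level⁺ : ℕ → List (Carrier ⁺)
    level⁺ d = ⊤⁺ ∷ map [_] (proj₁ (level-finite d))

    level⁺-spans : ∀ d a → rank⁺ a ≡ d → Any (a ≈⁺_) (level⁺ d)
    level⁺-spans d ⊤⁺    _ = here ⊤⁺≈⊤⁺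
    level⁺-spans d [ x ] r = there (Any.map⁺ (Any.map ≈[_] (proj₂ (level-finite d) x r)))

  AddGreatest : RankedPoset c (c ⊔ ℓ₁) (c ⊔ ℓ₂)
  AddGreatest = record
    { decPoset     = record { isDecPartialOrder = ≤⁺-isDecPartialOrder isDecPartialOrder }
    ; rank         = rank⁺
    ; rank-cong    = rank⁺-cong
    ; rank-zero    = λ _ → rank⁺-zero
    ; rank-⋖       = rank⁺-⋖
    ; rank-<       = rank⁺-<
    ; level-finite = λ d → level⁺ d , level⁺-spans d
    }

  addGreatest-least : Least P → Least AddGreatest
  addGreatest-least (⊥ , ⊥≤) = [ ⊥ ] , λ { [ x ] → ≤[ ⊥≤ x ] ; ⊤⁺ → _ ≤⊤⁺ }

  addGreatest-greatest : Greatest AddGreatest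
  addGreatest-greatest = ⊤⁺ , _≤⊤⁺

  addGreatest-hasRank : HasRank AddGreatest (suc m)
  addGreatest-hasRank =
    (λ { [ x ] → ℕ.m≤n⇒m≤1+n (proj₁ hasRank x) ; ⊤⁺ → ℕ.≤-refl }) , ⊤⁺ , refl

module _ (P : Fin n → RankedPoset c ℓ₁ ℓ₂) where
  private
    module P i = RankedPoset (P i)

  Union : Set c
  Union = Σ (Fin n) P.Carrier

  -- The order on a disjoint union whose elements are identified according
  -- to _~_: a lies below b iff this is the case in some component.
  GluedOrder : Rel Union ℓ → Rel Union (c ⊔ ℓ₂ ⊔ ℓ)
  GluedOrder _~_ a b =
    ∃ λ i → ∃₂ λ x y → a ~ (i , x) × P._≤_ i x y × (i , y) ~ b

  record IsIdentification (_~_ : Rel Union ℓ) : Set (c ⊔ ℓ₁ ⊔ ℓ₂ ⊔ ℓ) where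
    field
      isDecEquivalence : IsDecEquivalence _~_
      embed            : ∀ {i x y} → P._≈_ i x y → (i , x) ~ (i , y)
      reflect          : ∀ {i x y} → (i , x) ~ (i , y) → P._≈_ i x y
      rank-resp        : ∀ {i j x y} → (i , x) ~ (j , y) → P.rank i x ≡ P.rank j y
      compose          : ∀ {i j x y z w} → P._≤_ i x y → (i , y) ~ (j , z) → P._≤_ j z w →
                         GluedOrder _~_ (i , x) (j , w)

module _ (P : Fin n → RankedPoset c ℓ₁ ℓ₂) {_~_ : Rel (Union P) ℓ}
         (isIdentification : IsIdentification P _~_) where
  private
    module P i = RankedPoset (P i)
    module F i = Facts (P i)
    open IsIdentification isIdentification
    module ~ = IsDecEquivalence isDecEquivalence

    _≲_ : Rel (Union P) _
    _≲_ = GluedOrder P _~_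

    rank′ : Union P → ℕ
    rank′ (i , x) = P.rank i x

    ≲-trans : ∀ {a b c} → a ≲ b → b ≲ c → a ≲ c
    ≲-trans (_ , _ , _ , a~x , x≤y , y~b) (_ , _ , _ , b~z , z≤w , w~c)
      with compose x≤y (~.trans y~b b~z) z≤w
    ... | _ , _ , _ , x~u , u≤v , v~w = _ , _ , _ , ~.trans a~x x~u , u≤v , ~.trans v~w w~c

    ≲-reflexive : ∀ {a b} → a ~ b → a ≲ b
    ≲-reflexive a~b = _ , _ , _ , ~.refl , P.≤-refl _ , a~b

    rank′-≲ : ∀ {a b} → a ≲ b → rank′ a ℕ.≤ rank′ b
    rank′-≲ (i , _ , _ , a~x , x≤y , y~b) =
      subst₂ ℕ._≤_ (sym (rank-resp a~x)) (rank-resp y~b) (F.rank-≤ i x≤y)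

    ≲-rank : ∀ {a b} → a ≲ b → rank′ b ℕ.≤ rank′ a → a ~ b
    ≲-rank (i , _ , _ , a~x , x≤y , y~b) r = ~.trans a~x (~.trans (embed (F.rank-≈ i x≤y
      (subst₂ ℕ._≤_ (sym (rank-resp y~b)) (rank-resp a~x) r))) y~b)

    ≲-dec : Decidable _≲_
    ≲-dec a b = map′ to from (Fin.any? λ i → Any.any? (λ x → Any.any? (ok? i x) (ys i)) (xs i))
      where
      xs ys : ∀ i → List (P.Carrier i)
      xs i = proj₁ (P.level-finite i (rank′ a))
      ys i = proj₁ (P.level-finite i (rank′ b))

      Ok : ∀ i → Rel (P.Carrier i) _
      Ok i x y = a ~ (i , x) × P._≤_ i x y × (i , y) ~ b

      ok? : ∀ i x y → Dec (Ok i x y)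
      ok? i x y = (a ~.≟ (i , x)) ×-dec (P._≤?_ i x y) ×-dec ((i , y) ~.≟ b)

      to : (∃ λ i → Any (λ x → Any (Ok i x) (ys i)) (xs i)) → a ≲ b
      to (i , any) with Any.satisfied any
      ... | x , any′ with Any.satisfied any′
      ...   | y , ok = i , x , y , ok

      from : a ≲ b → ∃ λ i → Any (λ x → Any (Ok i x) (ys i)) (xs i)
      from (i , x , y , a~x , x≤y , y~b) = i ,
        Any.map (λ x≈x′ → Any.map
          (λ y≈y′ → ~.trans a~x (embed x≈x′)
                  , P.≤-respˡ i x≈x′ (P.≤-respʳ i y≈y′ x≤y)
                  , ~.trans (~.sym (embed y≈y′)) y~b)
          (proj₂ (P.level-finite i (rank′ b)) y (rank-resp y~b)))
        (proj₂ (P.level-finite i (rank′ a)) x (sym (rank-resp a~x)))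

    ≲-isDecPartialOrder : IsDecPartialOrder _~_ _≲_
    ≲-isDecPartialOrder = record
      { isPartialOrder = record
        { isPreorder = record
          { isEquivalence = ~.isEquivalence
          ; reflexive     = ≲-reflexive
          ; trans         = ≲-trans
          }
        ; antisym = λ a≲b b≲a → ≲-rank a≲b (rank′-≲ b≲a)
        }
      ; _≟_  = ~._≟_
      ; _≤?_ = ≲-dec
      }

    _<′_ : Rel (Union P) _
    _<′_ = ToStrict._<_ _~_ _≲_

    rank′-< : ∀ {a b} → a <′ b → rank′ a ℕ.< rank′ b
    rank′-< (a≲b , a≁b) = ℕ.≰⇒> (a≁b ∘ ≲-rank a≲b)

    rank′-⋖ : ∀ {a b} → a <′ b × (∀ z → ¬ (a <′ z × z <′ b)) → rank′ b ≡ suc (rank′ a)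
    rank′-⋖ {a} {b} (((i , x , y , a~x , x≤y , y~b) , a≁b) , none) = trans (sym (rank-resp y~b))
      (trans (P.rank-⋖ i ((x≤y , λ x≈y → a≁b (~.trans a~x (~.trans (embed x≈y) y~b))) , none′))
             (cong suc (sym (rank-resp a~x))))
      where
      none′ : ∀ z → ¬ (P._<_ i x z × P._<_ i z y)
      none′ z ((x≤z , x≉z) , (z≤y , z≉y)) = none (i , z)
        ( ((i , x , z , a~x , x≤z , ~.refl) , λ a~z → x≉z (reflect (~.trans (~.sym a~x) a~z)))
        , ((i , z , y , ~.refl , z≤y , y~b) , λ z~b → z≉y (reflect (~.trans z~b (~.sym y~b)))) )

    rank′-zero : Union P → ∃ λ a → (∀ b → ¬ (b <′ a)) × rank′ a ≡ 0
    rank′-zero (i , x) with P.rank-zero i x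
    ... | z , _ , rz≡0 = (i , z) , (λ b b<z → ℕ.n≮0 (subst (rank′ b ℕ.<_) rz≡0 (rank′-< b<z))) , rz≡0

    level′ : ℕ → List (Union P)
    level′ d = concatMap (λ i → map (i ,_) (proj₁ (P.level-finite i d))) (allFin n)

    level′-spans : ∀ d a → rank′ a ≡ d → Any (a ~_) (level′ d)
    level′-spans d (i , x) r = Any.concatMap⁺ _ (Any.map
      (λ { refl → Any.map⁺ (Any.map embed (proj₂ (P.level-finite i d) x r)) }) (∈-allFin i))

  Glue : RankedPoset c ℓ (c ⊔ ℓ₂ ⊔ ℓ)
  Glue = record
    { decPoset     = record { isDecPartialOrder = ≲-isDecPartialOrder }
    ; rank         = rank′
    ; rank-cong    = rank-resp
    ; rank-zero    = rank′-zero
    ; rank-⋖       = rank′-⋖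
    ; rank-<       = rank′-<
    ; level-finite = λ d → level′ d , level′-spans d
    }

module _ (P : Fin n → RankedPoset c ℓ₁ ℓ₂) where
  private
    module P i = RankedPoset (P i)

  data Same : Rel (Union P) (c ⊔ ℓ₁) where
    same : ∀ {i x y} → P._≈_ i x y → Same (i , x) (i , y)

  same? : Decidable Same
  same? (i , x) (j , y) with i Fin.≟ j
  ... | no i≢j = no λ { (same _) → i≢j refl }
  ... | yes refl = map′ same (λ { (same x≈y) → x≈y }) (P._≟_ i x y)

  private
    same-isIdentification : IsIdentification P Same
    same-isIdentification = record
      { isDecEquivalence = record
        { isEquivalence = record
          { refl  = same (P.Eq.refl _)
          ; sym   = λ { (same x≈y) → same (P.Eq.sym _ x≈y) }
          ; trans = λ { (same x≈y) (same y≈z) → same (P.Eq.trans _ x≈y y≈z) }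
          }
        ; _≟_ = same?
        }
      ; embed     = same
      ; reflect   = λ { (same x≈y) → x≈y }
      ; rank-resp = λ { (same x≈y) → P.rank-cong _ x≈y }
      ; compose   = λ { x≤y (same y≈z) z≤w →
          _ , _ , _ , same (P.Eq.refl _) , P.≤-trans _ (P.≤-respʳ _ y≈z x≤y) z≤w , same (P.Eq.refl _) }
      }

  DisjointUnion : RankedPoset c (c ⊔ ℓ₁) (c ⊔ ℓ₁ ⊔ ℓ₂)
  DisjointUnion = Glue P same-isIdentification

module _ (P : Fin n → RankedPoset c ℓ₁ ℓ₂) (least : ∀ i → Least (P i)) where
  private
    module P i = RankedPoset (P i)
    module F i = Facts (P i)

    ⊥ : ∀ i → P.Carrier i
    ⊥ i = proj₁ (least i)

    ≤⊥⇒≈⊥ : ∀ {i x y} → P._≤_ i x y → P._≈_ i y (⊥ i) → P._≈_ i x (⊥ i)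
    ≤⊥⇒≈⊥ {i} x≤y y≈⊥ = P.≤-antisym i (P.≤-respʳ i y≈⊥ x≤y) (proj₂ (least i) _)

    rank-≈⊥ : ∀ {i x} → P._≈_ i x (⊥ i) → P.rank i x ≡ 0
    rank-≈⊥ {i} x≈⊥ = trans (P.rank-cong i x≈⊥) (F.rank-least i (least i))

  data WedgeEq : Rel (Union P) (c ⊔ ℓ₁) where
    same   : ∀ {i x y} → P._≈_ i x y → WedgeEq (i , x) (i , y)
    leasts : ∀ {i j x y} → P._≈_ i x (proj₁ (least i)) → P._≈_ j y (proj₁ (least j)) →
             WedgeEq (i , x) (j , y)

  private
    wedge-sym : ∀ {a b} → WedgeEq a b → WedgeEq b a
    wedge-sym (same x≈y)         = same (P.Eq.sym _ x≈y)
    wedge-sym (leasts x≈⊥ y≈⊥)   = leasts y≈⊥ x≈⊥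

    wedge-trans : ∀ {a b c} → WedgeEq a b → WedgeEq b c → WedgeEq a c
    wedge-trans (same x≈y)       (same y≈z)       = same (P.Eq.trans _ x≈y y≈z)
    wedge-trans (same x≈y)       (leasts y≈⊥ z≈⊥) = leasts (P.Eq.trans _ x≈y y≈⊥) z≈⊥
    wedge-trans (leasts x≈⊥ y≈⊥) (same y≈z)       = leasts x≈⊥ (P.Eq.trans _ (P.Eq.sym _ y≈z) y≈⊥)
    wedge-trans (leasts x≈⊥ _)   (leasts _ z≈⊥)   = leasts x≈⊥ z≈⊥

    wedge-reflect : ∀ {i x y} → WedgeEq (i , x) (i , y) → P._≈_ i x y
    wedge-reflect (same x≈y)       = x≈y
    wedge-reflect (leasts x≈⊥ y≈⊥) = P.Eq.trans _ x≈⊥ (P.Eq.sym _ y≈⊥)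

    wedge? : Decidable WedgeEq
    wedge? (i , x) (j , y) with P._≟_ i x (⊥ i) ×-dec P._≟_ j y (⊥ j) | same? P (i , x) (j , y)
    ... | yes (x≈⊥ , y≈⊥) | _              = yes (leasts x≈⊥ y≈⊥)
    ... | no _            | yes (same x≈y) = yes (same x≈y)
    ... | no ¬⊥           | no ¬same       = no λ
      { (same x≈y) → ¬same (same x≈y) ; (leasts x≈⊥ y≈⊥) → ¬⊥ (x≈⊥ , y≈⊥) }

    wedge-rank : ∀ {i j x y} → WedgeEq (i , x) (j , y) → P.rank i x ≡ P.rank j y
    wedge-rank (same x≈y)       = P.rank-cong _ x≈y
    wedge-rank (leasts x≈⊥ y≈⊥) = trans (rank-≈⊥ x≈⊥) (sym (rank-≈⊥ y≈⊥))

    wedge-compose : ∀ {i j x y z w} → P._≤_ i x y → WedgeEq (i , y) (j , z) → P._≤_ j z w →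
                    GluedOrder P WedgeEq (i , x) (j , w)
    wedge-compose x≤y (same y≈z) z≤w =
      _ , _ , _ , same (P.Eq.refl _) , P.≤-trans _ (P.≤-respʳ _ y≈z x≤y) z≤w , same (P.Eq.refl _)
    wedge-compose x≤y (leasts y≈⊥ z≈⊥) z≤w =
      _ , _ , _ , leasts (≤⊥⇒≈⊥ x≤y y≈⊥) z≈⊥ , z≤w , same (P.Eq.refl _)

    wedge-isIdentification : IsIdentification P WedgeEq
    wedge-isIdentification = record
      { isDecEquivalence = record
        { isEquivalence = record
          { refl = same (P.Eq.refl _) ; sym = wedge-sym ; trans = wedge-trans }
        ; _≟_ = wedge?
        }
      ; embed     = same
      ; reflect   = wedge-reflect
      ; rank-resp = wedge-rank
      ; compose   = wedge-compose
      }

  WedgeProduct : RankedPoset c (c ⊔ ℓ₁) (c ⊔ ℓ₁ ⊔ ℓ₂)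
  WedgeProduct = Glue P wedge-isIdentification

module _ (P : Fin n → RankedPoset c ℓ₁ ℓ₂)
         (least : ∀ i → Least (P i)) (greatest : ∀ i → Greatest (P i))
         {m : ℕ} (hasRank : ∀ i → HasRank (P i) m) where
  private
    module P i = RankedPoset (P i)
    module F i = Facts (P i)

    ⊥ ⊤ : ∀ i → P.Carrier i
    ⊥ i = proj₁ (least i)
    ⊤ i = proj₁ (greatest i)

    ≤⊥⇒≈⊥ : ∀ {i x y} → P._≤_ i x y → P._≈_ i y (⊥ i) → P._≈_ i x (⊥ i)
    ≤⊥⇒≈⊥ {i} x≤y y≈⊥ = P.≤-antisym i (P.≤-respʳ i y≈⊥ x≤y) (proj₂ (least i) _)

    ⊤≤⇒≈⊤ : ∀ {i x y} → P._≤_ i x y → P._≈_ i x (⊤ i) → P._≈_ i y (⊤ i)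
    ⊤≤⇒≈⊤ {i} x≤y x≈⊤ = P.≤-antisym i (proj₂ (greatest i) _) (P.≤-respˡ i x≈⊤ x≤y)

    rank-≈⊥ : ∀ {i x} → P._≈_ i x (⊥ i) → P.rank i x ≡ 0
    rank-≈⊥ {i} x≈⊥ = trans (P.rank-cong i x≈⊥) (F.rank-least i (least i))

    rank-≈⊤ : ∀ {i x} → P._≈_ i x (⊤ i) → P.rank i x ≡ m
    rank-≈⊤ {i} x≈⊤ = trans (P.rank-cong i x≈⊤) (F.rank-greatest i (greatest i) (hasRank i))

    -- Only in rank 0 can an element be both least and greatest; then every
    -- component is a single point.
    collapse : ∀ {i j x y} → P._≈_ j y (⊥ j) → P._≈_ j y (⊤ j) → P._≈_ i x (⊤ i) → P._≈_ i x (⊥ i)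
    collapse {i} y≈⊥ y≈⊤ x≈⊤ = P.Eq.sym i (F.rank-≈ i (proj₂ (least i) _)
      (ℕ.≤-trans (ℕ.≤-reflexive (trans (rank-≈⊤ x≈⊤) (trans (sym (rank-≈⊤ y≈⊤)) (rank-≈⊥ y≈⊥)))) ℕ.z≤n))

  data DiamondEq : Rel (Union P) (c ⊔ ℓ₁) where
    same      : ∀ {i x y} → P._≈_ i x y → DiamondEq (i , x) (i , y)
    leasts    : ∀ {i j x y} → P._≈_ i x (proj₁ (least i)) → P._≈_ j y (proj₁ (least j)) →
                DiamondEq (i , x) (j , y)
    greatests : ∀ {i j x y} → P._≈_ i x (proj₁ (greatest i)) → P._≈_ j y (proj₁ (greatest j)) →
                DiamondEq (i , x) (j , y)

  private
    diamond-sym : ∀ {a b} → DiamondEq a b → DiamondEq b a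
    diamond-sym (same x≈y)          = same (P.Eq.sym _ x≈y)
    diamond-sym (leasts x≈⊥ y≈⊥)    = leasts y≈⊥ x≈⊥
    diamond-sym (greatests x≈⊤ y≈⊤) = greatests y≈⊤ x≈⊤

    diamond-trans : ∀ {a b c} → DiamondEq a b → DiamondEq b c → DiamondEq a c
    diamond-trans (same x≈y)          (same y≈z)          = same (P.Eq.trans _ x≈y y≈z)
    diamond-trans (same x≈y)          (leasts y≈⊥ z≈⊥)    = leasts (P.Eq.trans _ x≈y y≈⊥) z≈⊥
    diamond-trans (same x≈y)          (greatests y≈⊤ z≈⊤) = greatests (P.Eq.trans _ x≈y y≈⊤) z≈⊤
    diamond-trans (leasts x≈⊥ y≈⊥)    (same y≈z)          = leasts x≈⊥ (P.Eq.trans _ (P.Eq.sym _ y≈z) y≈⊥)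
    diamond-trans (leasts x≈⊥ _)      (leasts _ z≈⊥)      = leasts x≈⊥ z≈⊥
    diamond-trans (leasts x≈⊥ y≈⊥)    (greatests y≈⊤ z≈⊤) = leasts x≈⊥ (collapse y≈⊥ y≈⊤ z≈⊤)
    diamond-trans (greatests x≈⊤ y≈⊤) (same y≈z)          = greatests x≈⊤ (P.Eq.trans _ (P.Eq.sym _ y≈z) y≈⊤)
    diamond-trans (greatests x≈⊤ y≈⊤) (leasts y≈⊥ z≈⊥)    = leasts (collapse y≈⊥ y≈⊤ x≈⊤) z≈⊥
    diamond-trans (greatests x≈⊤ _)   (greatests _ z≈⊤)   = greatests x≈⊤ z≈⊤

    diamond-reflect : ∀ {i x y} → DiamondEq (i , x) (i , y) → P._≈_ i x y
    diamond-reflect (same x≈y)          = x≈y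
    diamond-reflect (leasts x≈⊥ y≈⊥)    = P.Eq.trans _ x≈⊥ (P.Eq.sym _ y≈⊥)
    diamond-reflect (greatests x≈⊤ y≈⊤) = P.Eq.trans _ x≈⊤ (P.Eq.sym _ y≈⊤)

    diamond? : Decidable DiamondEq
    diamond? (i , x) (j , y) with P._≟_ i x (⊥ i) ×-dec P._≟_ j y (⊥ j)
                                | P._≟_ i x (⊤ i) ×-dec P._≟_ j y (⊤ j)
                                | same? P (i , x) (j , y)
    ... | yes (x≈⊥ , y≈⊥) | _               | _              = yes (leasts x≈⊥ y≈⊥)
    ... | no _            | yes (x≈⊤ , y≈⊤) | _              = yes (greatests x≈⊤ y≈⊤)
    ... | no _            | no _            | yes (same x≈y) = yes (same x≈y)
    ... | no ¬⊥           | no ¬⊤           | no ¬same       = no λ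
      { (same x≈y)          → ¬same (same x≈y)
      ; (leasts x≈⊥ y≈⊥)    → ¬⊥ (x≈⊥ , y≈⊥)
      ; (greatests x≈⊤ y≈⊤) → ¬⊤ (x≈⊤ , y≈⊤)
      }

    diamond-rank : ∀ {i j x y} → DiamondEq (i , x) (j , y) → P.rank i x ≡ P.rank j y
    diamond-rank (same x≈y)          = P.rank-cong _ x≈y
    diamond-rank (leasts x≈⊥ y≈⊥)    = trans (rank-≈⊥ x≈⊥) (sym (rank-≈⊥ y≈⊥))
    diamond-rank (greatests x≈⊤ y≈⊤) = trans (rank-≈⊤ x≈⊤) (sym (rank-≈⊤ y≈⊤))

    diamond-compose : ∀ {i j x y z w} → P._≤_ i x y → DiamondEq (i , y) (j , z) → P._≤_ j z w →
                      GluedOrder P DiamondEq (i , x) (j , w)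
    diamond-compose x≤y (same y≈z) z≤w =
      _ , _ , _ , same (P.Eq.refl _) , P.≤-trans _ (P.≤-respʳ _ y≈z x≤y) z≤w , same (P.Eq.refl _)
    diamond-compose x≤y (leasts y≈⊥ z≈⊥) z≤w =
      _ , _ , _ , leasts (≤⊥⇒≈⊥ x≤y y≈⊥) z≈⊥ , z≤w , same (P.Eq.refl _)
    diamond-compose x≤y (greatests y≈⊤ z≈⊤) z≤w =
      _ , _ , _ , same (P.Eq.refl _) , x≤y , greatests y≈⊤ (⊤≤⇒≈⊤ z≤w z≈⊤)

    diamond-isIdentification : IsIdentification P DiamondEq
    diamond-isIdentification = record
      { isDecEquivalence = record
        { isEquivalence = record
          { refl = same (P.Eq.refl _) ; sym = diamond-sym ; trans = diamond-trans }
        ; _≟_ = diamond?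
        }
      ; embed     = same
      ; reflect   = diamond-reflect
      ; rank-resp = diamond-rank
      ; compose   = diamond-compose
      }

  DiamondProduct : RankedPoset c (c ⊔ ℓ₁) (c ⊔ ℓ₁ ⊔ ℓ₂)
  DiamondProduct = Glue P diamond-isIdentification

{-# OPTIONS --safe #-}
module Submission where

-- Fix a relation ∼ matching elements of P with elements of Q so that it
-- preserves and reflects the order and leaves at most one element of Q
-- unmatched.  A Macaulay order on P induces a total order on Q (the
-- unmatched element is put last), and the Macaulay condition carries
-- over from level d of P to level e of Q as soon as ∼ matches levels d, e and
-- levels d + 1, e + 1 completely.  In the levels that are not covered by such
-- a matching every element of level e lies below every element of level
-- e + 1: one of the two levels is a single glued or added element, or level
-- e + 1 is empty.  There the Macaulay condition holds for every total order,
-- because the shadow of each nonempty set is the whole level e + 1.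

open import Defs
open import Data.Empty using (⊥)
open import Data.Fin.Base using (Fin)
open import Data.List.Base using (List; []; _∷_; length; filter; deduplicate)
import Data.List.Extrema as Extrema
import Data.List.Membership.Setoid.Properties as Membership
open import Data.List.Properties using (filter-notAll)
open import Data.List.Relation.Binary.Pointwise.Base using (Pointwise; []; _∷_)
open import Data.List.Relation.Binary.Pointwise.Properties using (Pointwise-length)
open import Data.List.Relation.Unary.All as All using (All; []; _∷_)
open import Data.List.Relation.Unary.AllPairs using ([]; _∷_)
open import Data.List.Relation.Unary.Any as Any using (here; there)
open import Data.List.Relation.Unary.Unique.DecSetoid.Properties using (deduplicate-!)
import Data.List.Relation.Unary.Unique.Setoid.Properties as Unique
open import Data.Nat.Base as ℕ using (ℕ; zero; suc)
import Data.Nat.Properties as ℕ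
open import Data.Product.Base using (∃; ∃₂; _×_; _,_; proj₁; proj₂)
open import Data.Sum.Base using (_⊎_; inj₁; inj₂)
open import Data.Unit.Base using (⊤; tt)
open import Function.Base using (_∘_; flip)
open import Function.Bundles using (_⇔_; mk⇔; Equivalence)
import Function.Construct.Symmetry as Symmetry
open import Level using (Level; _⊔_; 0ℓ)
open import Relation.Binary.Bundles using (TotalOrder)
open import Relation.Binary.Core using (Rel; REL)
open import Relation.Binary.Construct.Add.Supremum.Equality using ([_]; ⊤⁺≈⊤⁺)
open import Relation.Binary.Construct.Add.Supremum.NonStrict using ([_]; _≤⊤⁺)
import Relation.Binary.Construct.NonStrictToStrict as ToStrict
open import Relation.Binary.PropositionalEquality using (_≡_; refl; sym; trans; cong; subst)
open import Relation.Binary.Structures using (IsDecTotalOrder)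
open import Relation.Nullary using (¬_; Dec; yes; no; contradiction)
open import Relation.Nullary.Construct.Add.Supremum using ([_]; ⊤⁺)
open import Relation.Unary using (Pred; _⊆_; _≐_)

open Equivalence using (to; from)

private
  variable
    c ℓ₁ ℓ₂ c′ ℓ₁′ ℓ₂′ ℓ ℓ′ r p q : Level

-- The Macaulay condition at one level; levels, shadows and segments.

MacaulayAt : (P : RankedPoset c ℓ₁ ℓ₂) → Rel (RankedPoset.Carrier P) ℓ → ℕ → Set _
MacaulayAt P _⊑_ d =
  ∀ A → Unique A → All (λ a → rank a ≡ d) A →
  let ∇Seg = ∇ P (Seg P _⊑_ d (length A)) in
  ∃₂ λ s t → _HasSize_ P ∇Seg s
           × _HasSize_ P (∇ P (_∈ A)) t
           × s ℕ.≤ t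
           × ∇Seg ≐ Seg P _⊑_ (suc d) s
  where open RankedPoset P

module _ (P : RankedPoset c ℓ₁ ℓ₂) where
  open RankedPoset P
  open Facts P

  -- A strictly intermediate element would need a rank strictly between two consecutive numbers.
  -- Thus covering between adjacent levels reduces to `_≤_`, and a matching has to respect only the
  -- order.
  ≤⇒⋖ : ∀ {a b} → a ≤ b → rank b ≡ suc (rank a) → a ⋖ b
  ≤⇒⋖ {a} a≤b r =
    (a≤b , λ a≈b → ℕ.1+n≢n (trans (sym r) (sym (rank-cong a≈b)))) ,
    λ { z (a<z , z<b) →
      ℕ.<⇒≱ (rank-< z<b) (ℕ.≤-trans (ℕ.≤-reflexive r) (rank-< a<z)) }

  -- The list from `level-finite` only spans the level: filtering discards other ranks,
  -- deduplication discards repetitions.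
  levelHasSize : ∀ d → ∃ (_HasSize_ P (λ x → rank x ≡ d))
  levelHasSize d = _ , deduplicate _≟_ level , deduplicate-! Eq.decSetoid level , refl ,
    (λ r → Membership.∈-deduplicate⁺ Eq.setoid _≟_ (λ y≈z x≈y → Eq.trans x≈y (Eq.sym y≈z))
      (Membership.∈-filter⁺ Eq.setoid d? resp (proj₂ (level-finite d) _ r) r)) ,
    (λ x∈ → proj₂ (Membership.∈-filter⁻ Eq.setoid d? resp {xs = proj₁ (level-finite d)}
      (Membership.∈-deduplicate⁻ Eq.setoid _≟_ level x∈)))
    where
    d? = λ x → rank x ℕ.≟ d

    level : List Carrier
    level = filter d? (proj₁ (level-finite d))

    resp : ∀ {x y} → x ≈ y → rank x ≡ d → rank y ≡ d
    resp x≈y r = trans (sym (rank-cong x≈y)) r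

  ∈-rank : ∀ {d x xs} → All (λ a → rank a ≡ d) xs → x ∈ xs → rank x ≡ d
  ∈-rank (r ∷ _)  (here x≈y) = trans (rank-cong x≈y) r
  ∈-rank (_ ∷ rs) (there x∈) = ∈-rank rs x∈

  ∇-rank : ∀ {S : Pred Carrier p} {d} → (∀ {a} → S a → rank a ≡ d) →
           ∀ {b} → ∇ P S b → rank b ≡ suc d
  ∇-rank S-rank (_ , s , a⋖b) = trans (rank-⋖ a⋖b) (cong suc (S-rank s))

  module _ {_⊑_ : Rel Carrier ℓ} (isDecTotalOrder : IsDecTotalOrder _≈_ _⊑_) where
    private
      module ⊑ = IsDecTotalOrder isDecTotalOrder
      open ToStrict _≈_ _⊑_ renaming (_<_ to _⊏_)

      totalOrder : TotalOrder _ _ _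
      totalOrder = record { isTotalOrder = ⊑.isTotalOrder }

      open Extrema totalOrder using (max; xs≤max; argmax-all)

    -- The largest element of a nonempty level lies in every segment of positive size.
    Seg-nonempty : ∀ {d a q} → rank a ≡ d → ∃ (Seg P _⊑_ d (suc q))
    Seg-nonempty {d} {a} ra with levelHasSize d
    ... | _ , xs , _ , _ , ∈xs , xs∈ =
      -- `top` has rank `d` because the default `a` and all entries of `xs` do. Nothing in the level
      -- is strictly above it, hence the count 0.
      top , argmax-all _ ra (All.tabulateₛ Eq.setoid xs∈) , 0 , ℕ.z<s , [] , [] , refl ,
      (λ { (ry , top⊑y , top≉y) → contradiction (⊑.antisym top⊑y (y⊑top ry)) top≉y }) , λ ()
      where
      top = max a xs

      y⊑top : ∀ {y} → rank y ≡ d → y ⊑ top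
      y⊑top ry = All.lookupₛ Eq.setoid (λ y≈z → ⊑.≤-respˡ-≈ y≈z) (xs≤max a xs) (∈xs ry)

    Seg-full : ∀ {d s} → _HasSize_ P (λ x → rank x ≡ d) s → (λ x → rank x ≡ d) ⊆ Seg P _⊑_ d s
    Seg-full {d} (xs , xs! , refl , ∈xs , xs∈) {x} rx = rx , _ ,
      -- `x` itself is in the list and is not strictly above itself, so the filtered list is
      -- strictly shorter.
      filter-notAll (x ⊏?_) xs (Any.map (λ x≈y x⊏y → proj₂ x⊏y x≈y) (∈xs rx)) ,
      filter (x ⊏?_) xs , Unique.filter⁺ Eq.setoid (x ⊏?_) xs! , refl ,
      (λ { (ry , x⊏y) → Membership.∈-filter⁺ Eq.setoid (x ⊏?_) resp (∈xs ry) x⊏y }) ,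
      (λ y∈ → let y∈xs , x⊏y = Membership.∈-filter⁻ Eq.setoid (x ⊏?_) resp y∈ in xs∈ y∈xs , x⊏y)
      where
      _⊏?_ = ToStrict.<-decidable _≈_ _⊑_ _≟_ ⊑._≤?_

      resp : ∀ {y z} → y ≈ z → x ⊏ y → x ⊏ z
      resp = ToStrict.<-respʳ-≈ _≈_ _⊑_ Eq.sym Eq.trans ⊑.≤-respʳ-≈

    -- For empty `A` the segment is empty too, and both shadows vanish. For nonempty `A` both
    -- shadows are all of level `d + 1`, so `s` and `t` agree, and by `Seg-full` that level is its
    -- own segment of size `s`.
    complete⇒macaulayAt : ∀ d → (∀ {a b} → rank a ≡ d → rank b ≡ suc d → a ≤ b) →
                          MacaulayAt P _⊑_ d
    complete⇒macaulayAt d complete [] _ _ =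
      0 , 0 ,
      ([] , [] , refl , (λ { (_ , (_ , _ , () , _) , _) }) , λ ()) ,
      ([] , [] , refl , (λ { (_ , () , _) }) , λ ()) ,
      ℕ.z≤n , (λ { (_ , (_ , _ , () , _) , _) }) , λ { (_ , _ , () , _) }
    complete⇒macaulayAt d complete (a ∷ as) _ (ra ∷ ras)
      with levelHasSize (suc d) | Seg-nonempty {q = length as} ra
    ... | s , size@(xs , xs! , refl , ∈xs , xs∈) | x , x∈Seg =
      s , s ,
      (xs , xs! , refl , (λ b∈ → ∈xs (∇-rank proj₁ b∈)) , λ b∈ → ∇Seg-all (xs∈ b∈)) ,
      (xs , xs! , refl ,
        (λ b∈ → ∈xs (∇-rank (∈-rank (ra ∷ ras)) b∈)) ,
        λ b∈ → a , here Eq.refl , covers ra (xs∈ b∈)) ,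
      ℕ.≤-refl , (λ b∈ → Seg-full size (∇-rank proj₁ b∈)) , λ { (rb , _) → ∇Seg-all rb }
      where
      ∇Seg = ∇ P (Seg P _⊑_ d (suc (length as)))

      covers : ∀ {a b} → rank a ≡ d → rank b ≡ suc d → a ⋖ b
      covers ra rb = ≤⇒⋖ (complete ra rb) (trans rb (cong suc (sym ra)))

      ∇Seg-all : ∀ {b} → rank b ≡ suc d → ∇Seg b
      ∇Seg-all rb = x , x∈Seg , covers (proj₁ x∈Seg) rb

-- Matchings between two ranked posets.

module _ (P : RankedPoset c ℓ₁ ℓ₂) (Q : RankedPoset c′ ℓ₁′ ℓ₂′)
         (_∼_ : REL (RankedPoset.Carrier P) (RankedPoset.Carrier Q) r) where
  private
    module P = RankedPoset P
    module Q = RankedPoset Q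

  Matches : Rel P.Carrier ℓ → Rel Q.Carrier ℓ′ → Set _
  Matches R S = ∀ {a b a′ b′} → a ∼ b → a′ ∼ b′ → R a a′ ⇔ S b b′

  -- The matching is a relation, since a glued element has several equal representatives as
  -- partners. Here it is total in both directions; that it is one-to-one up to equality comes from
  -- `≈⇔`. The two ranks may differ because removing least elements shifts them.
  record LevelMatching (d e : ℕ) : Set (c ⊔ c′ ⊔ r) where
    field
      forth : ∀ {a} → P.rank a ≡ d → ∃ λ b → Q.rank b ≡ e × a ∼ b
      back  : ∀ {b} → Q.rank b ≡ e → ∃ λ a → P.rank a ≡ d × a ∼ b

  record OrderMatching (_⊑_ : Rel P.Carrier ℓ) (_⊑′_ : Rel Q.Carrier ℓ′) :
         Set (c ⊔ ℓ₁ ⊔ ℓ₂ ⊔ c′ ⊔ ℓ₁′ ⊔ ℓ₂′ ⊔ r ⊔ ℓ ⊔ ℓ′) where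
    field
      ≈⇔ : Matches P._≈_ Q._≈_
      ≤⇔ : Matches P._≤_ Q._≤_
      ⊑⇔ : Matches _⊑_ _⊑′_

  -- By antisymmetry an equality is a pair of inequalities, which transfer separately.
  matches-≈ : Matches P._≤_ Q._≤_ → Matches P._≈_ Q._≈_
  matches-≈ ≤⇔ a∼b a′∼b′ = mk⇔
    (λ a≈a′ → Q.≤-antisym (to (≤⇔ a∼b a′∼b′) (P.≤-reflexive a≈a′))
                          (to (≤⇔ a′∼b′ a∼b) (P.≤-reflexive (P.Eq.sym a≈a′))))
    (λ b≈b′ → P.≤-antisym (from (≤⇔ a∼b a′∼b′) (Q.≤-reflexive b≈b′))
                          (from (≤⇔ a′∼b′ a∼b) (Q.≤-reflexive (Q.Eq.sym b≈b′))))

-- Transport of sizes, segments, shadows and the Macaulay condition along a matching.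

module _ {P : RankedPoset c ℓ₁ ℓ₂} {Q : RankedPoset c′ ℓ₁′ ℓ₂′}
         {_∼_ : REL (RankedPoset.Carrier P) (RankedPoset.Carrier Q) r} where
  private
    module P = RankedPoset P
    module Q = RankedPoset Q

  flip-level : ∀ {d e} → LevelMatching P Q _∼_ d e → LevelMatching Q P (flip _∼_) e d
  flip-level level = record { forth = back ; back = forth }
    where open LevelMatching level

  flip-order : {_⊑_ : Rel P.Carrier ℓ} {_⊑′_ : Rel Q.Carrier ℓ′} →
               OrderMatching P Q _∼_ _⊑_ _⊑′_ → OrderMatching Q P (flip _∼_) _⊑′_ _⊑_
  flip-order order = record
    { ≈⇔ = λ a b → Symmetry.equivalence (≈⇔ a b)
    ; ≤⇔ = λ a b → Symmetry.equivalence (≤⇔ a b)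
    ; ⊑⇔ = λ a b → Symmetry.equivalence (⊑⇔ a b)
    }
    where open OrderMatching order

  module Matched {_⊑_ : Rel P.Carrier ℓ} {_⊑′_ : Rel Q.Carrier ℓ′}
                 (order : OrderMatching P Q _∼_ _⊑_ _⊑′_) where
    open OrderMatching order

    ∈-matched : ∀ {xs ys a b} → Pointwise _∼_ xs ys → a ∼ b → (a P.∈ xs) ⇔ (b Q.∈ ys)
    ∈-matched {a = a} {b} xs∼ys a∼b = mk⇔ (f xs∼ys) (g xs∼ys)
      where
      f : ∀ {xs ys} → Pointwise _∼_ xs ys → a P.∈ xs → b Q.∈ ys
      f (x∼y ∷ _)   (here a≈x) = here (to (≈⇔ a∼b x∼y) a≈x)
      f (_ ∷ xs∼ys) (there a∈) = there (f xs∼ys a∈)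

      g : ∀ {xs ys} → Pointwise _∼_ xs ys → b Q.∈ ys → a P.∈ xs
      g (x∼y ∷ _)   (here b≈y) = here (from (≈⇔ a∼b x∼y) b≈y)
      g (_ ∷ xs∼ys) (there b∈) = there (g xs∼ys b∈)

    unique-matched : ∀ {xs ys} → Pointwise _∼_ xs ys → P.Unique xs → Q.Unique ys
    unique-matched []            []         = []
    unique-matched (x∼y ∷ xs∼ys) (x∉ ∷ xs!) = fresh xs∼ys x∉ ∷ unique-matched xs∼ys xs!
      where
      fresh : ∀ {xs ys} → Pointwise _∼_ xs ys →
              All (λ z → ¬ (_ P.≈ z)) xs → All (λ z → ¬ (_ Q.≈ z)) ys
      fresh []            []         = []
      fresh (z∼w ∷ zs∼ws) (x≉z ∷ x∉) = (x≉z ∘ from (≈⇔ x∼y z∼w)) ∷ fresh zs∼ws x∉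

    module _ {d e} (level : LevelMatching P Q _∼_ d e) where
      open LevelMatching level

      match-list : ∀ {xs} → All (λ x → P.rank x ≡ d) xs →
                   ∃ λ ys → Pointwise _∼_ xs ys × All (λ y → Q.rank y ≡ e) ys
      match-list []       = [] , [] , []
      match-list (r ∷ rs) with forth r | match-list rs
      ... | y , ry , x∼y | ys , xs∼ys , rys = y ∷ ys , x∼y ∷ xs∼ys , ry ∷ rys

      -- Replacing each entry of an enumeration of `S` by a partner keeps the length and, by `≈⇔`,
      -- the absence of repetitions. Confining `S` and `T` to matched levels guarantees that every
      -- element involved has a partner.
      hasSize-matched : ∀ {S : Pred P.Carrier p} {T : Pred Q.Carrier q} {k} →
        (∀ {a} → S a → P.rank a ≡ d) → (∀ {b} → T b → Q.rank b ≡ e) →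
        (∀ {a b} → a ∼ b → P.rank a ≡ d → Q.rank b ≡ e → S a ⇔ T b) →
        _HasSize_ P S k → _HasSize_ Q T k
      hasSize-matched S-rank T-rank S⇔T (xs , xs! , refl , ∈xs , xs∈)
        with match-list (All.tabulateₛ P.Eq.setoid (λ x∈ → S-rank (xs∈ x∈)))
      ... | ys , xs∼ys , rys = ys , unique-matched xs∼ys xs! , sym (Pointwise-length xs∼ys) ,
        (λ t → let a , ra , a∼b = back (T-rank t) in
          to (∈-matched xs∼ys a∼b) (∈xs (from (S⇔T a∼b ra (T-rank t)) t))) ,
        λ b∈ → let rb = ∈-rank Q rys b∈ ; a , ra , a∼b = back rb in
          to (S⇔T a∼b ra rb) (xs∈ (from (∈-matched xs∼ys a∼b) b∈))

      -- Membership in a segment is a count of larger elements within one level, and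
      -- `hasSize-matched` preserves this count.
      seg-matched : ∀ q {a b} → a ∼ b → Q.rank b ≡ e → Seg P _⊑_ d q a → Seg Q _⊑′_ e q b
      seg-matched q x∼y ry (_ , k , k<q , size) = ry , k , k<q ,
        hasSize-matched proj₁ proj₁ (λ z∼w rz rw → mk⇔
          (λ { (_ , x⊑z , x≉z) → rw , to (⊑⇔ x∼y z∼w) x⊑z , x≉z ∘ from (≈⇔ x∼y z∼w) })
          (λ { (_ , y⊑w , y≉w) → rz , from (⊑⇔ x∼y z∼w) y⊑w , y≉w ∘ to (≈⇔ x∼y z∼w) }))
          size

      -- Only the inequality is carried over, since intermediate elements need not be matched. The
      -- rank of `b` then makes it a covering again, by `≤⇒⋖`.
      ∇-matched : ∀ {S : Pred P.Carrier p} {T : Pred Q.Carrier q} →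
        (∀ {a} → S a → P.rank a ≡ d) → (∀ {a b} → a ∼ b → Q.rank b ≡ e → S a → T b) →
        ∀ {a b} → a ∼ b → Q.rank b ≡ suc e → ∇ P S a → ∇ Q T b
      ∇-matched S-rank S→T a∼b rb (x , s , (x≤a , _) , _) with forth (S-rank s)
      ... | y , ry , x∼y = y , S→T x∼y ry s ,
        ≤⇒⋖ Q (to (≤⇔ x∼y a∼b) x≤a) (trans rb (cong suc (sym ry)))

module _ {P : RankedPoset c ℓ₁ ℓ₂} {Q : RankedPoset c′ ℓ₁′ ℓ₂′}
         {_∼_ : REL (RankedPoset.Carrier P) (RankedPoset.Carrier Q) r} where
  private
    module P = RankedPoset P
    module Q = RankedPoset Q

  -- The set `B` is pulled back to a set `A`; the condition for `A` is then pushed forward with the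
  -- same sizes `s` and `t`.
  macaulayAt-matched : {_⊑_ : Rel P.Carrier ℓ} {_⊑′_ : Rel Q.Carrier ℓ′} →
    OrderMatching P Q _∼_ _⊑_ _⊑′_ → ∀ {d e} →
    LevelMatching P Q _∼_ d e → LevelMatching P Q _∼_ (suc d) (suc e) →
    MacaulayAt P _⊑_ d → MacaulayAt Q _⊑′_ e
  macaulayAt-matched {_⊑_ = _⊑_} {_⊑′_} order {d} {e} level level⁺ macaulay B B! rB
    with Matched.match-list (flip-order order) (flip-level level) rB
  -- The rewrite replaces `length B` by `length A`, so the segments in both posets have the same
  -- nominal size.
  ... | A , B∼A , rA rewrite Pointwise-length B∼A
    with macaulay A (Matched.unique-matched (flip-order order) B∼A B!) rA
  ... | s , t , ∇Seg-size , ∇A-size , s≤t , ∇Seg⊆Seg , Seg⊆∇Seg = s , t ,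
    M.hasSize-matched level⁺ (∇-rank P proj₁) (∇-rank Q proj₁)
      (λ a∼b ra rb → mk⇔ (∇Seg→ a∼b rb) (∇Seg← a∼b ra)) ∇Seg-size ,
    M.hasSize-matched level⁺ (∇-rank P (∈-rank P rA)) (∇-rank Q (∈-rank Q rB))
      (λ a∼b ra rb → mk⇔
        (M.∇-matched level (∈-rank P rA) (λ x∼y _ → from (M⁻.∈-matched B∼A x∼y)) a∼b rb)
        (M⁻.∇-matched (flip-level level) (∈-rank Q rB) (λ x∼y _ → to (M⁻.∈-matched B∼A x∼y)) a∼b ra))
      ∇A-size ,
    s≤t ,
    (λ b∈ → let rb = ∇-rank Q proj₁ b∈ ; a , ra , a∼b = LevelMatching.back level⁺ rb in
      M.seg-matched level⁺ s a∼b rb (∇Seg⊆Seg (∇Seg← a∼b ra b∈))) ,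
    λ b∈ → let rb = proj₁ b∈ ; a , ra , a∼b = LevelMatching.back level⁺ rb in
      ∇Seg→ a∼b rb (Seg⊆∇Seg (M⁻.seg-matched (flip-level level⁺) s a∼b ra b∈))
    where
    module M  = Matched order
    module M⁻ = Matched (flip-order order)

    ∇Seg→ : ∀ {a b} → a ∼ b → Q.rank b ≡ suc e →
            ∇ P (Seg P _⊑_ d (length A)) a → ∇ Q (Seg Q _⊑′_ e (length A)) b
    ∇Seg→ = M.∇-matched level proj₁ (M.seg-matched level (length A))

    ∇Seg← : ∀ {a b} → a ∼ b → P.rank a ≡ suc d →
            ∇ Q (Seg Q _⊑′_ e (length A)) b → ∇ P (Seg P _⊑_ d (length A)) a
    ∇Seg← = M⁻.∇-matched (flip-level level) proj₁ (M⁻.seg-matched (flip-level level) (length A))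

-- The induced total order and the transfer of the Macaulay property.

module Transfer {P : RankedPoset c ℓ₁ ℓ₂} {Q : RankedPoset c′ ℓ₁′ ℓ₂′}
  (_∼_ : REL (RankedPoset.Carrier P) (RankedPoset.Carrier Q) r)
  (≤⇔ : Matches P Q _∼_ (RankedPoset._≤_ P) (RankedPoset._≤_ Q))
  (∼-respʳ : ∀ {a b b′} → a ∼ b → RankedPoset._≈_ Q b b′ → a ∼ b′)
  (matched? : ∀ b → Dec (∃ λ a → a ∼ b))
  (unmatched : ∀ {b b′} → ¬ (∃ λ a → a ∼ b) → ¬ (∃ λ a → a ∼ b′) → RankedPoset._≈_ Q b b′)
  where
  private
    module P = RankedPoset P
    module Q = RankedPoset Q

    ≈⇔ : Matches P Q _∼_ P._≈_ Q._≈_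
    ≈⇔ = matches-≈ P Q _∼_ ≤⇔

  module _ {_⊑_ : Rel P.Carrier 0ℓ} (isDecTotalOrder : IsDecTotalOrder P._≈_ _⊑_) where
    private
      module ⊑ = IsDecTotalOrder isDecTotalOrder

      Match : Pred Q.Carrier _
      Match b = ∃ λ a → a ∼ b

      -- Unmatched elements come last.
      compare : ∀ {b b′} → Dec (Match b) → Dec (Match b′) → Set
      compare _             (no _)         = ⊤
      compare (no _)        (yes _)        = ⊥
      compare (yes (a , _)) (yes (a′ , _)) = a ⊑ a′

    infix 4 _⊑′_
    _⊑′_ : Rel Q.Carrier 0ℓ
    b ⊑′ b′ = compare (matched? b) (matched? b′)

    ⊑′-isDecTotalOrder : IsDecTotalOrder Q._≈_ _⊑′_
    ⊑′-isDecTotalOrder = record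
      { isTotalOrder = record
        { isPartialOrder = record
          { isPreorder = record
            { isEquivalence = Q.Eq.isEquivalence
            ; reflexive     = ⊑′-reflexive
            ; trans         = λ {x} {y} {z} → ⊑′-trans x y z
            }
          ; antisym = λ {x} {y} → ⊑′-antisym x y
          }
        ; total = ⊑′-total
        }
      ; _≟_  = Q._≟_
      ; _≤?_ = ⊑′-dec
      }
      where
      ⊑′-reflexive : ∀ {x y} → x Q.≈ y → x ⊑′ y
      ⊑′-reflexive {x} {y} x≈y with matched? x | matched? y
      ... | _             | no _           = tt
      -- An element equal to a matched one is itself matched.
      ... | no none       | yes (a , a∼y)  = none (a , ∼-respʳ a∼y (Q.Eq.sym x≈y))
      ... | yes (_ , a∼x) | yes (_ , a′∼y) = ⊑.reflexive (from (≈⇔ a∼x a′∼y) x≈y)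

      ⊑′-trans : ∀ x y z → x ⊑′ y → y ⊑′ z → x ⊑′ z
      ⊑′-trans x y z x⊑y y⊑z with matched? x | matched? y | matched? z
      ... | _     | _     | no _  = tt
      ... | no _  | yes _ | yes _ = x⊑y
      ... | yes _ | yes _ | yes _ = ⊑.trans x⊑y y⊑z

      ⊑′-antisym : ∀ x y → x ⊑′ y → y ⊑′ x → x Q.≈ y
      ⊑′-antisym x y x⊑y y⊑x with matched? x | matched? y
      -- Antisymmetry is where it matters that at most one element, up to equality, is unmatched.
      ... | no none       | no none′       = unmatched none none′
      ... | yes (_ , a∼x) | yes (_ , a′∼y) = to (≈⇔ a∼x a′∼y) (⊑.antisym x⊑y y⊑x)

      ⊑′-total : ∀ x y → x ⊑′ y ⊎ y ⊑′ x
      ⊑′-total x y with matched? x | matched? y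
      ... | _           | no _         = inj₁ tt
      ... | no _        | yes _        = inj₂ tt
      ... | yes (a , _) | yes (a′ , _) = ⊑.total a a′

      ⊑′-dec : ∀ x y → Dec (x ⊑′ y)
      ⊑′-dec x y with matched? x | matched? y
      ... | _           | no _         = yes tt
      ... | no _        | yes _        = no λ ()
      ... | yes (a , _) | yes (a′ , _) = a ⊑.≤? a′

    order : OrderMatching P Q _∼_ _⊑_ _⊑′_
    order = record { ≈⇔ = ≈⇔ ; ≤⇔ = ≤⇔ ; ⊑⇔ = ⊑⇔ }
      where
      ⊑⇔ : Matches P Q _∼_ _⊑_ _⊑′_
      ⊑⇔ {a} {b} {a′} {b′} a∼b a′∼b′ with matched? b | matched? b′
      ... | no none       | _               = contradiction (a , a∼b) none
      ... | yes _         | no none         = contradiction (a′ , a′∼b′) none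
      -- `matched?` may have chosen partners other than `a` and `a′`; by `≈⇔` they are equal to
      -- these.
      ... | yes (_ , x∼b) | yes (_ , x′∼b′) = mk⇔
        (λ a⊑a′ → ⊑.≤-respˡ-≈ a≈x (⊑.≤-respʳ-≈ a′≈x′ a⊑a′))
        (λ x⊑x′ → ⊑.≤-respˡ-≈ (P.Eq.sym a≈x) (⊑.≤-respʳ-≈ (P.Eq.sym a′≈x′) x⊑x′))
        where
        a≈x   = from (≈⇔ a∼b x∼b) Q.Eq.refl
        a′≈x′ = from (≈⇔ a′∼b′ x′∼b′) Q.Eq.refl

  macaulay-transfer :
    (∀ e → (∀ {a b} → Q.rank a ≡ e → Q.rank b ≡ suc e → a Q.≤ b)
         ⊎ ∃ λ d → LevelMatching P Q _∼_ d e × LevelMatching P Q _∼_ (suc d) (suc e)) →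
    Macaulay P → Macaulay Q
  macaulay-transfer levels (_⊑_ , isDecTotalOrder , macaulay) =
    _⊑′_ isDecTotalOrder , ⊑′-isDecTotalOrder isDecTotalOrder , macaulayAt
    where
    macaulayAt : ∀ e → MacaulayAt Q (_⊑′_ isDecTotalOrder) e
    macaulayAt e with levels e
    ... | inj₁ complete = complete⇒macaulayAt Q (⊑′-isDecTotalOrder isDecTotalOrder) e complete
    ... | inj₂ (d , level , level⁺) =
      macaulayAt-matched (order isDecTotalOrder) level level⁺ (macaulay d)

-- Disjoint unions and wedge products.

module _ {n : ℕ} (P : Fin n → RankedPoset c ℓ₁ ℓ₂) where
  private
    module P i = RankedPoset (P i)

  -- The order before any gluing. Pattern matching on it identifies the two indices, so that the
  -- order of either disjoint union can be recovered from it.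
  data Within : Rel (Union P) (c ⊔ ℓ₂) where
    within : ∀ {i x y} → P._≤_ i x y → Within (i , x) (i , y)

module _ {n : ℕ} (P : Fin n → RankedPoset c ℓ₁ ℓ₂) (least : ∀ i → Least (P i)) where
  private
    module P i = RankedPoset (P i)
    module F i = Facts (P i)

    U⁻ = DisjointUnion λ i → RemoveLeast (P i) (least i)
    U  = DisjointUnion P
    W  = WedgeProduct P least

    module U⁻ = RankedPoset U⁻
    module U  = RankedPoset U
    module W  = RankedPoset W

  IsLeast : Pred (Union P) _
  IsLeast (i , x) = P._≈_ i x (proj₁ (least i))

  private
    isLeast? : ∀ a → Dec (IsLeast a)
    isLeast? (i , x) = P._≟_ i x (proj₁ (least i))

    isLeast-≈ : ∀ {a b} → a W.≈ b → IsLeast b → IsLeast a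
    isLeast-≈ (same x≈y)     y≈⊥ = P.Eq.trans _ x≈y y≈⊥
    isLeast-≈ (leasts x≈⊥ _) _   = x≈⊥

    rank-zero⇒isLeast : ∀ {a} → W.rank a ≡ 0 → IsLeast a
    rank-zero⇒isLeast {i , x} r =
      P.Eq.sym i (F.rank-≈ i (proj₂ (least i) x) (ℕ.≤-trans (ℕ.≤-reflexive r) ℕ.z≤n))

    rank-suc⇒nonLeast : ∀ {a d} → W.rank a ≡ suc d → ¬ IsLeast a
    rank-suc⇒nonLeast {i , x} r x≈⊥ =
      ℕ.1+n≢0 (trans (sym r) (trans (P.rank-cong i x≈⊥) (F.rank-least i (least i))))

    suc-pred-rank : ∀ {a} → ¬ IsLeast a → suc (ℕ.pred (W.rank a)) ≡ W.rank a
    suc-pred-rank {a} ¬⊥ with W.rank a in eq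
    ... | zero  = contradiction (rank-zero⇒isLeast eq) ¬⊥
    ... | suc _ = refl

    -- Everything of rank 0 equals the glued least element, which can be represented in the
    -- component of `b`.
    wedge-complete : ∀ {a b} → W.rank a ≡ 0 → W.rank b ≡ 1 → a W.≤ b
    wedge-complete {b = j , y} ra _ = j , proj₁ (least j) , y ,
      leasts (rank-zero⇒isLeast ra) (P.Eq.refl j) , proj₂ (least j) y , W.Eq.refl

    -- Gluing affects least elements only. If the upper end were least, then `a`, lying below it,
    -- would be least as well.
    nonLeast-≤ : ∀ {a b} → ¬ IsLeast a → a W.≤ b → Within P a b
    nonLeast-≤ ¬⊥ (_ , _ , _ , leasts x≈⊥ _ , _ , _) = contradiction x≈⊥ ¬⊥
    nonLeast-≤ ¬⊥ (i , _ , _ , same x≈u , u≤v , same v≈y) =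
      within (P.≤-respˡ i (P.Eq.sym i x≈u) (P.≤-respʳ i v≈y u≤v))
    nonLeast-≤ ¬⊥ (i , _ , _ , same x≈u , u≤v , leasts v≈⊥ _) = contradiction
      (P.≤-antisym i (P.≤-respʳ i v≈⊥ (P.≤-respˡ i (P.Eq.sym i x≈u) u≤v)) (proj₂ (least i) _)) ¬⊥

    within⇒≤ : ∀ {a b} → Within P a b → a U.≤ b
    within⇒≤ (within x≤y) = _ , _ , _ , U.Eq.refl , x≤y , U.Eq.refl

    embed-≈ : ∀ {a b} → Same P a b → a W.≈ b
    embed-≈ (same x≈y) = same x≈y

    embed-≤ : ∀ {a b} → a U.≤ b → a W.≤ b
    embed-≤ (_ , _ , _ , a≈x , x≤y , y≈b) = _ , _ , _ , embed-≈ a≈x , x≤y , embed-≈ y≈b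

    infix 4 _∼⁻_ _∼_
    _∼⁻_ : REL U⁻.Carrier W.Carrier _
    (i , x , _) ∼⁻ b = (i , x) W.≈ b

    -- The least elements of different components are incomparable in `U` but equal in `W`.
    -- Excluding them keeps the matching faithful to the order.
    _∼_ : REL U.Carrier W.Carrier _
    a ∼ b = ¬ IsLeast a × a W.≈ b

    conjugate : ∀ {a b a′ b′} → a W.≈ b → a′ W.≈ b′ → a W.≤ a′ → b W.≤ b′
    conjugate a≈b a′≈b′ a≤a′ = W.≤-respˡ a≈b (W.≤-respʳ a′≈b′ a≤a′)

    ∼⁻-≤⇔ : Matches U⁻ W _∼⁻_ U⁻._≤_ W._≤_
    ∼⁻-≤⇔ {_ , _ , x≉⊥} a∼b a′∼b′ = mk⇔
      (λ { (_ , _ , _ , same x≈u , u≤v , same v≈y) →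
        conjugate a∼b a′∼b′ (_ , _ , _ , same x≈u , u≤v , same v≈y) })
      (λ b≤b′ → lower (nonLeast-≤ x≉⊥ (conjugate (W.Eq.sym a∼b) (W.Eq.sym a′∼b′) b≤b′)))
      where
      lower : ∀ {i x x≉⊥ j y y≉⊥} → Within P (i , x) (j , y) → (i , x , x≉⊥) U⁻.≤ (j , y , y≉⊥)
      lower (within x≤y) = _ , _ , _ , U⁻.Eq.refl , x≤y , U⁻.Eq.refl

    -- Ranks drop by one when the least elements are removed, hence the offset.
    ∼⁻-level : ∀ d → LevelMatching U⁻ W _∼⁻_ d (suc d)
    ∼⁻-level d = record
      { forth = λ { {i , x , x≉⊥} r →
          (i , x) , trans (sym (suc-pred-rank {i , x} x≉⊥)) (cong suc r) , W.Eq.refl }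
      ; back  = λ { {i , x} r →
          (i , x , rank-suc⇒nonLeast {i , x} r) , cong ℕ.pred r , W.Eq.refl }
      }

  -- The glued least element is the only unmatched one. Its level 0 has no counterpart in `U⁻` and
  -- is settled by completeness.
  disjointUnion⁻⇒wedge : Macaulay U⁻ → Macaulay W
  disjointUnion⁻⇒wedge = macaulay-transfer λ
    { zero    → inj₁ wedge-complete
    ; (suc d) → inj₂ (d , ∼⁻-level d , ∼⁻-level (suc d))
    }
    where
    matched? : ∀ b → Dec (∃ λ a → a ∼⁻ b)
    matched? b@(j , y) with isLeast? b
    ... | yes y≈⊥ = no λ { ((_ , _ , x≉⊥) , a∼b) → x≉⊥ (isLeast-≈ a∼b y≈⊥) }
    ... | no  y≉⊥ = yes ((j , y , y≉⊥) , W.Eq.refl)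

    isLeast : ∀ {b} → ¬ (∃ λ a → a ∼⁻ b) → IsLeast b
    isLeast {b@(j , y)} none with isLeast? b
    ... | yes y≈⊥ = y≈⊥
    ... | no  y≉⊥ = contradiction ((j , y , y≉⊥) , W.Eq.refl) none

    open Transfer {P = U⁻} {W} _∼⁻_ ∼⁻-≤⇔ W.Eq.trans matched?
      (λ none none′ → leasts (isLeast none) (isLeast none′))

  -- Every element and every level of `U⁻` is matched, so no exceptional level arises.
  wedge⇒disjointUnion⁻ : Macaulay W → Macaulay U⁻
  wedge⇒disjointUnion⁻ = macaulay-transfer λ d →
    inj₂ (suc d , flip-level (∼⁻-level d) , flip-level (∼⁻-level (suc d)))
    where
    respˡ : ∀ {a a′ b} → a ∼⁻ b → a U⁻.≈ a′ → a′ ∼⁻ b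
    respˡ a∼b (same x≈y) = W.Eq.trans (same (P.Eq.sym _ x≈y)) a∼b

    matched? : ∀ a → Dec (∃ λ b → a ∼⁻ b)
    matched? (i , x , _) = yes ((i , x) , W.Eq.refl)

    open Transfer {P = W} {U⁻} (flip _∼⁻_) (λ a b → Symmetry.equivalence (∼⁻-≤⇔ a b)) respˡ matched?
      (λ none → contradiction (_ , W.Eq.refl) none)

  -- Positive levels contain no least elements, so they agree in `U` and `W` with the same rank;
  -- level 0 of `W` is complete.
  disjointUnion⇒wedge : Macaulay U → Macaulay W
  disjointUnion⇒wedge = macaulay-transfer λ
    { zero    → inj₁ wedge-complete
    ; (suc d) → inj₂ (suc d , level d , level (suc d))
    }
    where
    level : ∀ d → LevelMatching U W _∼_ (suc d) (suc d)
    level d = record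
      { forth = λ {a} r → a , r , rank-suc⇒nonLeast {a} r , W.Eq.refl
      ; back  = λ {b} r → b , r , rank-suc⇒nonLeast {b} r , W.Eq.refl
      }

    matched? : ∀ b → Dec (∃ λ a → a ∼ b)
    matched? b with isLeast? b
    ... | yes b≈⊥ = no λ { (_ , a≉⊥ , a≈b) → a≉⊥ (isLeast-≈ a≈b b≈⊥) }
    ... | no  b≉⊥ = yes (b , b≉⊥ , W.Eq.refl)

    isLeast : ∀ {b} → ¬ (∃ λ a → a ∼ b) → IsLeast b
    isLeast {b} none with isLeast? b
    ... | yes b≈⊥ = b≈⊥
    ... | no  b≉⊥ = contradiction (b , b≉⊥ , W.Eq.refl) none

    ≤⇔ : Matches U W _∼_ U._≤_ W._≤_
    ≤⇔ (a≉⊥ , a≈b) (_ , a′≈b′) = mk⇔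
      (conjugate a≈b a′≈b′ ∘ embed-≤)
      (within⇒≤ ∘ nonLeast-≤ a≉⊥ ∘ conjugate (W.Eq.sym a≈b) (W.Eq.sym a′≈b′))

    open Transfer {P = U} {W} _∼_ ≤⇔ (λ a∼b b≈b′ → proj₁ a∼b , W.Eq.trans (proj₂ a∼b) b≈b′) matched?
      (λ none none′ → leasts (isLeast none) (isLeast none′))

-- Wedge products and diamond products with added greatest elements.

module _ {n : ℕ} (P : Fin n → RankedPoset c ℓ₁ ℓ₂) (least : ∀ i → Least (P i))
         {m : ℕ} (hasRank : ∀ i → HasRank (P i) m) (maximals : ∀ i → MaximalsHaveRank (P i) m) where
  private
    module P i = RankedPoset (P i)

    P⁺ : Fin n → RankedPoset _ _ _
    P⁺ i = AddGreatest (P i) (hasRank i) (maximals i)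

    W  = WedgeProduct P least
    D⁺ = DiamondProduct P⁺
      (λ i → addGreatest-least (P i) (hasRank i) (maximals i) (least i))
      (λ i → addGreatest-greatest (P i) (hasRank i) (maximals i))
      (λ i → addGreatest-hasRank (P i) (hasRank i) (maximals i))

    module W  = RankedPoset W
    module D⁺ = RankedPoset D⁺

    lift : W.Carrier → D⁺.Carrier
    lift (i , x) = i , [ x ]

    infix 4 _∼_
    _∼_ : REL W.Carrier D⁺.Carrier _
    a ∼ b = lift a D⁺.≈ b

    lift-≈ : ∀ {a b} → a W.≈ b → lift a D⁺.≈ lift b
    lift-≈ (same x≈y)       = same [ x≈y ]
    lift-≈ (leasts x≈⊥ y≈⊥) = leasts [ x≈⊥ ] [ y≈⊥ ]

    lift-≤ : ∀ {a b} → a W.≤ b → lift a D⁺.≤ lift b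
    lift-≤ (_ , _ , _ , a≈x , x≤y , y≈b) = _ , _ , _ , lift-≈ a≈x , [ x≤y ] , lift-≈ y≈b

    lower-≈ : ∀ {a b} → lift a D⁺.≈ lift b → a W.≈ b
    lower-≈ (same [ x≈y ])           = same x≈y
    lower-≈ (leasts [ x≈⊥ ] [ y≈⊥ ]) = leasts x≈⊥ y≈⊥

    lower-≤ : ∀ {a b} → lift a D⁺.≤ lift b → a W.≤ b
    lower-≤ (_ , [ _ ] , [ _ ] , a≈x , [ x≤y ] , y≈b) = _ , _ , _ , lower-≈ a≈x , x≤y , lower-≈ y≈b
    -- An added element equals only added elements, so it cannot be the upper end of an inequality
    -- between lifted elements.
    lower-≤ (_ , _ , ⊤⁺ , _ , _ , same ())
    lower-≤ (_ , _ , ⊤⁺ , _ , _ , leasts () _)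
    lower-≤ (_ , _ , ⊤⁺ , _ , _ , greatests _ ())

    ≤⇔ : Matches W D⁺ _∼_ W._≤_ D⁺._≤_
    ≤⇔ a∼b a′∼b′ = mk⇔
      (λ a≤a′ → D⁺.≤-respˡ a∼b (D⁺.≤-respʳ a′∼b′ (lift-≤ a≤a′)))
      (λ b≤b′ → lower-≤ (D⁺.≤-respˡ (D⁺.Eq.sym a∼b) (D⁺.≤-respʳ (D⁺.Eq.sym a′∼b′) b≤b′)))

    matched? : ∀ b → Dec (∃ λ a → a ∼ b)
    matched? (i , [ x ]) = yes ((i , x) , D⁺.Eq.refl)
    matched? (i , ⊤⁺)    = no λ { (_ , same ()) ; (_ , leasts _ ()) ; (_ , greatests () _) }

    level : ∀ {d} → d ℕ.≤ m → LevelMatching W D⁺ _∼_ d d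
    level d≤m = record
      { forth = λ {a} r → lift a , r , D⁺.Eq.refl
      ; back  = λ { {i , [ x ]} r → (i , x) , r , D⁺.Eq.refl
                  ; {i , ⊤⁺} refl → contradiction d≤m ℕ.1+n≰n }
      }

  wedge⇒diamond⁺ : Macaulay W → Macaulay D⁺
  wedge⇒diamond⁺ = macaulay-transfer levels
    where
    unmatched : ∀ {b b′} → ¬ (∃ λ a → a ∼ b) → ¬ (∃ λ a → a ∼ b′) → b D⁺.≈ b′
    unmatched {i , [ x ]} none _ = contradiction ((i , x) , D⁺.Eq.refl) none
    unmatched {_ , ⊤⁺} {i , [ x ]} _ none = contradiction ((i , x) , D⁺.Eq.refl) none
    unmatched {_ , ⊤⁺} {_ , ⊤⁺} _ _ = greatests ⊤⁺≈⊤⁺ ⊤⁺≈⊤⁺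

    open Transfer {P = W} {D⁺} _∼_ ≤⇔ D⁺.Eq.trans matched? unmatched

    levels : ∀ e → (∀ {a b} → D⁺.rank a ≡ e → D⁺.rank b ≡ suc e → a D⁺.≤ b)
                 ⊎ ∃ λ d → LevelMatching W D⁺ _∼_ d e × LevelMatching W D⁺ _∼_ (suc d) (suc e)
    levels e with e ℕ.<? m
    ... | yes e<m = inj₂ (e , level (ℕ.<⇒≤ e<m) , level e<m)
    -- From `m ≤ e` on, level `e + 1` contains at most the added element, which is above everything.
    ... | no  e≮m = inj₁ λ
      { {i , x} {_ , ⊤⁺} _ _ → i , x , ⊤⁺ , D⁺.Eq.refl , (x ≤⊤⁺) , greatests ⊤⁺≈⊤⁺ ⊤⁺≈⊤⁺
      ; {_} {j , [ y ]} _ r → contradiction (subst (ℕ._≤ m) r (proj₁ (hasRank j) y)) e≮m }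

  diamond⁺⇒wedge : Macaulay D⁺ → Macaulay W
  diamond⁺⇒wedge = macaulay-transfer levels
    where
    open Transfer {P = D⁺} {W} (flip _∼_) (λ a b → Symmetry.equivalence (≤⇔ a b))
      (λ a∼b a≈a′ → D⁺.Eq.trans (lift-≈ (W.Eq.sym a≈a′)) a∼b)
      (λ a → yes (lift a , D⁺.Eq.refl))
      (λ none → contradiction (_ , D⁺.Eq.refl) none)

    levels : ∀ e → (∀ {a b} → W.rank a ≡ e → W.rank b ≡ suc e → a W.≤ b)
                 ⊎ ∃ λ d → LevelMatching D⁺ W (flip _∼_) d e × LevelMatching D⁺ W (flip _∼_) (suc d) (suc e)
    levels e with e ℕ.<? m
    ... | yes e<m = inj₂ (e , flip-level (level (ℕ.<⇒≤ e<m)) , flip-level (level e<m))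
    -- Here level `e + 1` of `W` is empty, since its ranks do not exceed `m`.
    ... | no  e≮m = inj₁ λ { {b = j , y} _ r →
      contradiction (subst (ℕ._≤ m) r (proj₁ (hasRank j) y)) e≮m }

-- Wedge and diamond products of the same posets.

module _ {n : ℕ} (P : Fin n → RankedPoset c ℓ₁ ℓ₂)
         (least : ∀ i → Least (P i)) (greatest : ∀ i → Greatest (P i))
         {m : ℕ} (hasRank : ∀ i → HasRank (P i) m) where
  private
    module P i = RankedPoset (P i)
    module F i = Facts (P i)

    W = WedgeProduct P least
    D = DiamondProduct P least greatest hasRank

    module W = RankedPoset W
    module D = RankedPoset D

  IsGreatest : Pred (Union P) _
  IsGreatest (i , x) = P._≈_ i x (proj₁ (greatest i))

  private
    isGreatest? : ∀ a → Dec (IsGreatest a)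
    isGreatest? (i , x) = P._≟_ i x (proj₁ (greatest i))

    rank-greatest : ∀ i → P.rank i (proj₁ (greatest i)) ≡ m
    rank-greatest i = F.rank-greatest i (greatest i) (hasRank i)

    infix 4 _∼_
    -- The greatest elements are glued in `D` but not in `W`, so they are left out of the matching.
    _∼_ : REL W.Carrier D.Carrier _
    a ∼ b = ¬ IsGreatest a × a D.≈ b

    raise-≈ : ∀ {a b} → a W.≈ b → a D.≈ b
    raise-≈ (same x≈y)       = same x≈y
    raise-≈ (leasts x≈⊥ y≈⊥) = leasts x≈⊥ y≈⊥

    raise-≤ : ∀ {a b} → a W.≤ b → a D.≤ b
    raise-≤ (_ , _ , _ , a≈x , x≤y , y≈b) = _ , _ , _ , raise-≈ a≈x , x≤y , raise-≈ y≈b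

    nonGreatest-≈ : ∀ {a b} → ¬ IsGreatest a → a D.≈ b → a W.≈ b
    nonGreatest-≈ _  (same x≈y)       = same x≈y
    nonGreatest-≈ _  (leasts x≈⊥ y≈⊥) = leasts x≈⊥ y≈⊥
    nonGreatest-≈ ¬⊤ (greatests x≈⊤ _) = contradiction x≈⊤ ¬⊤

    -- The inequality inside a component is kept; only the two outer identifications have to be read
    -- in `W`, and neither can be a gluing of greatest elements.
    nonGreatest-≤ : ∀ {a b} → ¬ IsGreatest a → ¬ IsGreatest b → a D.≤ b → a W.≤ b
    nonGreatest-≤ a≉⊤ b≉⊤ (_ , _ , _ , a≈x , x≤y , y≈b) = _ , _ , _ ,
      nonGreatest-≈ a≉⊤ a≈x , x≤y , W.Eq.sym (nonGreatest-≈ b≉⊤ (D.Eq.sym y≈b))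

    rank⇒isGreatest : ∀ {a} → m ℕ.≤ W.rank a → IsGreatest a
    rank⇒isGreatest {i , x} m≤r =
      F.rank-≈ i (proj₂ (greatest i) x) (ℕ.≤-trans (ℕ.≤-reflexive (rank-greatest i)) m≤r)

    isGreatest⇒rank : ∀ {a} → IsGreatest a → W.rank a ≡ m
    isGreatest⇒rank {i , x} x≈⊤ = trans (P.rank-cong i x≈⊤) (rank-greatest i)

    -- Greatest elements are recognised by their rank `m`. This also covers `m` equal to 0, where
    -- least and greatest elements coincide.
    isGreatest-≈ : ∀ {a b} → a D.≈ b → IsGreatest b → IsGreatest a
    isGreatest-≈ a≈b b≈⊤ =
      rank⇒isGreatest (ℕ.≤-reflexive (sym (trans (D.rank-cong a≈b) (isGreatest⇒rank b≈⊤))))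

  wedge⇒diamond : Macaulay W → Macaulay D
  wedge⇒diamond = macaulay-transfer levels
    where
    matched? : ∀ b → Dec (∃ λ a → a ∼ b)
    matched? b with isGreatest? b
    ... | yes b≈⊤ = no λ { (_ , a≉⊤ , a≈b) → a≉⊤ (isGreatest-≈ a≈b b≈⊤) }
    ... | no  b≉⊤ = yes (b , b≉⊤ , D.Eq.refl)

    isGreatest : ∀ {b} → ¬ (∃ λ a → a ∼ b) → IsGreatest b
    isGreatest {b} none with isGreatest? b
    ... | yes b≈⊤ = b≈⊤
    ... | no  b≉⊤ = contradiction (b , b≉⊤ , D.Eq.refl) none

    ≤⇔ : Matches W D _∼_ W._≤_ D._≤_
    ≤⇔ (a≉⊤ , a≈b) (a′≉⊤ , a′≈b′) = mk⇔
      (λ a≤a′ → D.≤-respˡ a≈b (D.≤-respʳ a′≈b′ (raise-≤ a≤a′)))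
      (λ b≤b′ → nonGreatest-≤ a≉⊤ a′≉⊤
        (D.≤-respˡ (D.Eq.sym a≈b) (D.≤-respʳ (D.Eq.sym a′≈b′) b≤b′)))

    open Transfer {P = W} {D} _∼_ ≤⇔ (λ a∼b b≈b′ → proj₁ a∼b , D.Eq.trans (proj₂ a∼b) b≈b′) matched?
      (λ none none′ → greatests (isGreatest none) (isGreatest none′))

    level : ∀ {d} → d ℕ.< m → LevelMatching W D _∼_ d d
    level d<m = record
      { forth = λ {a} r → a , r , below r , D.Eq.refl
      ; back  = λ {b} r → b , r , below r , D.Eq.refl
      }
      where
      below : ∀ {a} → W.rank a ≡ _ → ¬ IsGreatest a
      below r a≈⊤ = ℕ.<⇒≢ d<m (trans (sym r) (isGreatest⇒rank a≈⊤))

    levels : ∀ e → (∀ {a b} → D.rank a ≡ e → D.rank b ≡ suc e → a D.≤ b)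
                 ⊎ ∃ λ d → LevelMatching W D _∼_ d e × LevelMatching W D _∼_ (suc d) (suc e)
    -- Both `e` and `e + 1` must be below `m`, because level `m` of `D` is the unmatched glued
    -- element.
    levels e with suc e ℕ.<? m
    ... | yes 1+e<m = inj₂ (e , level (ℕ.<⇒≤ 1+e<m) , level 1+e<m)
    -- An element of rank `e + 1`, which is at least `m`, must be greatest, hence equal to the
    -- greatest element in the component of the lower one.
    ... | no  1+e≮m = inj₁ λ { {i , x} {b} _ r →
      i , x , proj₁ (greatest i) , D.Eq.refl , proj₂ (greatest i) x ,
      greatests (P.Eq.refl i)
        (rank⇒isGreatest {b} (ℕ.≤-trans (ℕ.≮⇒≥ 1+e≮m) (ℕ.≤-reflexive (sym r)))) }

theorem4p4 : ∀ {c ℓ₁ ℓ₂} {n : ℕ} (P : Fin n → RankedPoset c ℓ₁ ℓ₂) →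
    ((least : ∀ i → Least (P i)) →
    (Macaulay (DisjointUnion (λ i → RemoveLeast (P i) (least i)))
    ⇔ Macaulay (WedgeProduct P least))
    × ((m : ℕ) (hasRank : ∀ i → HasRank (P i) m)
    (maximals : ∀ i → MaximalsHaveRank (P i) m) →
    Macaulay (WedgeProduct P least)
    ⇔ Macaulay (DiamondProduct
    (λ i → AddGreatest (P i) (hasRank i) (maximals i))
    (λ i → addGreatest-least (P i) (hasRank i) (maximals i) (least i))
    (λ i → addGreatest-greatest (P i) (hasRank i) (maximals i))
    (λ i → addGreatest-hasRank (P i) (hasRank i) (maximals i)))))
    × ((least : ∀ i → Least (P i)) →
    Macaulay (DisjointUnion P) → Macaulay (WedgeProduct P least))
    × ((least : ∀ i → Least (P i)) (greatest : ∀ i → Greatest (P i))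
    (m : ℕ) (hasRank : ∀ i → HasRank (P i) m) →
    Macaulay (WedgeProduct P least)
    → Macaulay (DiamondProduct P least greatest hasRank))
theorem4p4 P =
  (λ least →
    mk⇔ (disjointUnion⁻⇒wedge P least) (wedge⇒disjointUnion⁻ P least) ,
    λ m hasRank maximals →
      mk⇔ (wedge⇒diamond⁺ P least hasRank maximals) (diamond⁺⇒wedge P least hasRank maximals)) ,
  disjointUnion⇒wedge P ,
  λ least greatest m hasRank → wedge⇒diamond P least greatest hasRank
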